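{- Let $H$ be a linear hypertree with maximum degree $\Delta(H) = 2$ and anti-rank three. Then $\hat{n}(H) = 0$; that is, $H$ itself (with no added isolated vertices) is the niche hypergraph $NH(D)$ of some acyclic digraph $D$.
   Context: All hypergraphs are simple (if $e \subseteq e'$ for hyperedges $e,e'$ then $e=e'$) and have no loops (hyperedges with exactly one vertex). The degree of a vertex is the number of hyperedges containing it, and $\Delta(H)$ is the maximum degree. The anti-rank of a hypergraph is the minimum number of vertices of a hyperedge. A hypergraph is linear if $|e \cap e'| \le 1$ for all distinct hyperedges $e, e'$. A hypergraph $H$ is a hypertree if there is a (graph) tree $T$ with $V(T) = V(H)$ such that for every hyperedge $e$ the induced subgraph $T[e]$ is connected. Digraphs have no pair of opposite arcs; a digraph is acyclic if it contains no directed cycle. For a digraph $D$, $N^-_D(v)=\{u:(u,v)\in A(D)\}$ and $N^+_D(v)=\{u:(v,u)\in A(D)\}$. The niche hypergraph $NH(D)$ of a digraph $D$ has vertex set $V(D)$ and hyperedge set $\{e \subseteq V(D): |e| \ge 2 \text{ and } e = N^-_D(v) \text{ or } e = N^+_D(v) \text{ for some } v \in V(D)\}$. For a hypergraph $H$, the niche number $\hat{n}(H)$ is the minimum $k \ge 0$ such that $H$ together with $k$ additional isolated vertices is the niche hypergraph of an acyclic digraph ($\hat{n}(H)=\infty$ if no such $k$ exists). -}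

module Defs where

open import Data.Nat using (ℕ; _≤_)
open import Data.Bool using (Bool; true)
open import Data.Fin using (Fin)
open import Data.Fin.Subset using (Subset; _∩_; ∣_∣; _⊆_) renaming (_∈_ to _∈ₛ_)
open import Data.Fin.Subset.Properties using (_∈?_)
open import Data.Vec using (tabulate)
open import Data.List using (List; []; _∷_; _++_; [_]; length; filter)
open import Data.List.Membership.Propositional using (_∈_)
open import Data.List.Relation.Unary.Unique.Propositional using (Unique)
open import Data.Product using (Σ; _×_; ∃; ∃-syntax)
open import Data.Sum using (_⊎_)
open import Relation.Nullary using (¬_)
open import Data.Empty using (⊥)
import Data.Unit
open import Relation.Binary.PropositionalEquality using (_≡_; _≢_)
open import Relation.Binary.Construct.Closure.Transitive using (TransClosure)
open import Relation.Binary.Construct.Closure.ReflexiveTransitive using (Star)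

record Hypergraph : Set where
  field
    n       : ℕ
    E       : List (Subset n)
    distinct : Unique E
    simple  : ∀ {e e'} → e ∈ E → e' ∈ E → e ⊆ e' → e ≡ e'
    noLoops : ∀ {e} → e ∈ E → 2 ≤ ∣ e ∣

open Hypergraph public

degree : (H : Hypergraph) → Fin (n H) → ℕ
degree H v = length (filter (λ e → v ∈? e) (E H))

MaxDegree : Hypergraph → ℕ → Set
MaxDegree H k = (∀ v → degree H v ≤ k) × (∃[ v ] degree H v ≡ k)

AntiRank : Hypergraph → ℕ → Set
AntiRank H k = (∀ {e} → e ∈ E H → k ≤ ∣ e ∣) × (∃[ e ] (e ∈ E H × ∣ e ∣ ≡ k))

Linear : Hypergraph → Set
Linear H = ∀ {e e'} → e ∈ E H → e' ∈ E H → e ≢ e' → ∣ e ∩ e' ∣ ≤ 1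

record Graph (n : ℕ) : Set where
  field
    adj    : Fin n → Fin n → Bool
    sym    : ∀ u v → adj u v ≡ adj v u
    irrefl : ∀ v → ¬ (adj v v ≡ true)

Adj : ∀ {n} → Graph n → Fin n → Fin n → Set
Adj G u v = Graph.adj G u v ≡ true

Chain : ∀ {n} → Graph n → List (Fin n) → Set
Chain G []           = Data.Unit.⊤
Chain G (x ∷ [])     = Data.Unit.⊤
Chain G (x ∷ y ∷ xs) = Adj G x y × Chain G (y ∷ xs)

HasCycle : ∀ {n} → Graph n → Set
HasCycle {n} G = Σ (Fin n) λ x → Σ (List (Fin n)) λ ws →
  2 ≤ length ws × Unique (x ∷ ws) × Chain G (x ∷ ws ++ [ x ])

Connected : ∀ {n} → Graph n → Set
Connected G = ∀ u v → Star (Adj G) u v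

IsTree : ∀ {n} → Graph n → Set
IsTree G = Connected G × ¬ HasCycle G

InducedConnected : ∀ {n} → Graph n → Subset n → Set
InducedConnected G e =
  ∀ {u v} → u ∈ₛ e → v ∈ₛ e → Star (λ a b → Adj G a b × a ∈ₛ e × b ∈ₛ e) u v

IsHypertree : Hypergraph → Set
IsHypertree H = Σ (Graph (n H)) λ T → IsTree T × (∀ {e} → e ∈ E H → InducedConnected T e)

record Digraph (n : ℕ) : Set where
  field
    arc     : Fin n → Fin n → Bool
    noOpp   : ∀ u v → arc u v ≡ true → ¬ (arc v u ≡ true)
    noLoop  : ∀ v → ¬ (arc v v ≡ true)

Arc : ∀ {n} → Digraph n → Fin n → Fin n → Set
Arc D u v = Digraph.arc D u v ≡ true

Acyclic : ∀ {n} → Digraph n → Set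
Acyclic D = ∀ v → ¬ TransClosure (Arc D) v v

N⁻ : ∀ {n} → Digraph n → Fin n → Subset n
N⁻ D v = tabulate (λ u → Digraph.arc D u v)

N⁺ : ∀ {n} → Digraph n → Fin n → Subset n
N⁺ D v = tabulate (λ u → Digraph.arc D v u)

NicheEdge : ∀ {n} → Digraph n → Subset n → Set
NicheEdge {n} D e = 2 ≤ ∣ e ∣ × Σ (Fin n) (λ v → e ≡ N⁻ D v ⊎ e ≡ N⁺ D v)

IsNicheHypergraphOf : (H : Hypergraph) → Digraph (n H) → Set
IsNicheHypergraphOf H D = ∀ e → (e ∈ E H → NicheEdge D e) × (NicheEdge D e → e ∈ E H)

{-# OPTIONS --safe #-}

-- Root the tree T at a vertex of degree 2.  By linearity two hyperedges can only meet at the vertex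
-- closest to the root of one of them, so if the hyperedges are sorted by the depth of these tops, each
-- of them meets its predecessors in at most one vertex.
--
-- Every hyperedge e receives a side and a site v, asking for e = N⁻(v) or e = N⁺(v); the digraph is the
-- union of the arcs this forces.  Such a placement is realised by an acyclic digraph if the sites
-- are distinct and, for a linear order of the hyperedges:
--   the site of e lies in f, for e and f of one side, only if f is smaller than e;
--   the site of e lies in f, for e and f of different sides, iff the site of f lies in e;
--   a common vertex of two hyperedges of one side is the site of a hyperedge of the other side.
--
-- Such placements are built by attaching stars: a hyperedge g together with pairwise disjoint hyperedges
-- f₁, …, fₜ, where f₁ meets g.  If g has a suitable vertex that lies in no other hyperedge placed so far,
-- then this is the site of f₁, and g has its site in f₁.  Otherwise g meets some f₂ as well; then g and f₁ get
-- the same side, the site of f₁ is the vertex of g ∩ f₂, that of f₂ is the vertex of g ∩ f₁, and that of g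
-- is in f₂.  The remaining fᵢ form a chain, each having its site in the next one.  If the vertex at which g
-- is attached is the site of a hyperedge of the wrong side, that hyperedge is moved to the end of the chain.
module Submission where

open import Defs
open import Data.Bool using (Bool; true; false; not)
import Data.Bool.Properties as Bool
open import Data.Empty using (⊥; ⊥-elim)
open import Data.Fin using (Fin)
import Data.Fin as Fin
open import Data.Fin.Properties using (any?)
open import Data.Fin.Subset using (Subset; ∣_∣) renaming (_∈_ to _∈ₛ_; _∉_ to _∉ₛ_)
open import Data.Fin.Subset.Properties using (_∈?_; nonempty?; Empty-unique; ∣⊥∣≡0; ⊆-antisym; ∣⁅x⁆∣≡1; x∈⁅y⁆⇒x≡y; p⊂q⇒∣p∣<∣q∣; x∈p∩q⁺)
open import Data.List using (List; []; _∷_; _++_; length; map; filter)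
open import Data.List.Properties using (map-∘; map-cong; length-++; length-filter; ++-identityʳ; ∷-injective)
open import Data.List.Membership.Propositional using (_∈_; _∉_; find; lose)
open import Data.List.Membership.Propositional.Properties using (∈-map⁺; ∈-map⁻; ∈-++⁺ˡ; ∈-++⁺ʳ; ∈-++⁻; ∈-AllPairs₂; ∈-filter⁺; ∈-filter⁻)
open import Data.List.Membership.DecPropositional using () renaming (_∈?_ to ∈L?)
open import Data.List.Relation.Binary.Permutation.Propositional using (↭-sym; ↭⇒↭ₛ)
open import Data.List.Relation.Binary.Permutation.Propositional.Properties using (∈-resp-↭)
import Data.List.Relation.Binary.Permutation.Setoid.Properties as ↭ₛ
open import Data.List.Relation.Binary.Subset.Propositional using (_⊆_)
import Data.List.Relation.Binary.Subset.Propositional.Properties as ⊆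
open import Data.List.Relation.Unary.All as All using (All; []; _∷_)
import Data.List.Relation.Unary.All.Properties as All
open import Data.List.Relation.Unary.AllPairs as AllPairs using (AllPairs; []; _∷_)
import Data.List.Relation.Unary.AllPairs.Properties as AllPairs
open import Data.List.Relation.Unary.Any as Any using (here; there)
open import Data.List.Relation.Unary.Sorted.TotalOrder.Properties using (Sorted⇒AllPairs)
open import Data.List.Relation.Unary.Unique.Propositional using (Unique)
import Data.List.Relation.Unary.Unique.Propositional.Properties as Unique
import Data.List.Sort as Sort
open import Data.Maybe using (Maybe; just; nothing)
open import Data.Maybe.Properties using (just-injective) renaming (≡-dec to ≡ᵐ-dec)
open import Data.Nat using (ℕ; zero; suc; _≤_; _<_; z≤n; s≤s)
import Data.Nat.Properties as ℕ
open import Data.Product using (Σ; _×_; _,_; proj₁; proj₂; ∃; ∃-syntax)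
open import Data.Sum using (_⊎_; inj₁; inj₂; [_,_]′)
import Data.Sum as Sum
open import Data.Unit using (tt)
open import Data.Vec using ([]; _∷_; here; there; tabulate)
open import Data.Vec.Properties using (≡-dec; lookup∘tabulate; []=⇒lookup; lookup⇒[]=)
open import Relation.Binary.Bundles using (DecTotalOrder)
import Relation.Binary.Construct.On as On
open import Relation.Binary.Construct.Closure.ReflexiveTransitive as Star using (Star; ε; _◅_; _◅◅_)
open import Relation.Binary.Construct.Closure.Transitive using (TransClosure; [_]) renaming (_∷_ to _∷⁺_)
open import Relation.Binary.PropositionalEquality hiding ([_])
open import Relation.Nullary using (¬_; Dec; yes; no; does; contradiction)
open import Relation.Nullary.Decidable using (_×-dec_; _⊎-dec_; ¬?; dec-true)

-- Simple paths and rooted trees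

-- ws lists the vertices after v on a walk from v to r without repetition.
data Path {n} (R : Fin n → Fin n → Set) (r : Fin n) : Fin n → List (Fin n) → Set where
  []   : Path R r r []
  step : ∀ {v w ws} → R v w → Path R r w ws → v ∉ w ∷ ws → Path R r v (w ∷ ws)

suffix : ∀ {n} {R : Fin n → Fin n → Set} {r v w ws} → Path R r w ws → v ∈ w ∷ ws →
  ∃[ vs ] (Path R r v vs × v ∷ vs ⊆ w ∷ ws)
suffix p            (here refl) = _ , p , λ q → q
suffix (step _ p _) (there v∈)  = let vs , q , vs⊆ = suffix p v∈ in vs , q , λ z∈ → there (vs⊆ z∈)

simplify : ∀ {n} {R : Fin n → Fin n → Set} {r v} → Star R v r → ∃[ vs ] Path R r v vs
simplify ε = [] , []
simplify {v = v} (_◅_ {j = w} a s) with simplify s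
... | ws , p with ∈L? Fin._≟_ v (w ∷ ws)
...   | no v∉  = w ∷ ws , step a p v∉
...   | yes v∈ = let vs , q , _ = suffix p v∈ in vs , q

path-unique-vertices : ∀ {n} {R : Fin n → Fin n → Set} {r v vs} → Path R r v vs → Unique (v ∷ vs)
path-unique-vertices []            = [] ∷ []
path-unique-vertices (step a p v∉) = All.¬Any⇒All¬ _ v∉ ∷ path-unique-vertices p

end∈ : ∀ {n} {R : Fin n → Fin n → Set} {r v vs} → Path R r v vs → r ∈ v ∷ vs
end∈ []           = here refl
end∈ (step _ p _) = there (end∈ p)

module Rooted {n} (T : Graph n) (connected : Connected T) (no-cycle : ¬ HasCycle T) (r : Fin n) where

  adj-sym : ∀ {u v} → Adj T u v → Adj T v u
  adj-sym {u} {v} a = trans (Graph.sym T v u) a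

  Away : Fin n → Fin n → Fin n → Set
  Away v x y = Adj T x y × x ≢ v × y ≢ v

  -- The walk may be taken without repetitions, and closing it through `v` gives a cycle.
  away-cycle : ∀ {v a b} → Adj T v a → Adj T v b → a ≢ b → Star (Away v) a b → ⊥
  away-cycle {v} {a} {b} va vb a≢b s with simplify s
  ... | [] , [] = a≢b refl
  ... | ws@(w ∷ ws′) , p@(step (_ , a≢v , _) _ _) =
    no-cycle (v , a ∷ ws , s≤s (s≤s z≤n) , avoid a≢v p ∷ path-unique-vertices p , va , close p)
    where
    avoid : ∀ {x xs} → x ≢ v → Path (Away v) b x xs → All (v ≢_) (x ∷ xs)
    avoid x≢v []                          = ≢-sym x≢v ∷ []
    avoid x≢v (step (_ , _ , y≢v) p _) = ≢-sym x≢v ∷ avoid y≢v p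
    close : ∀ {x xs} → Path (Away v) b x xs → Chain T (x ∷ xs ++ v ∷ [])
    close []               = adj-sym vb , tt
    close (step (a , _) p _) = a , close p

  path-away : ∀ {v w ws} → Path (Adj T) r w ws → v ∉ w ∷ ws → Star (Away v) w r
  path-away []           v∉ = ε
  path-away (step a p _) v∉ =
    (a , (λ { refl → v∉ (here refl) }) , (λ { refl → v∉ (there (here refl)) })) ◅ path-away p (λ q → v∉ (there q))

  -- Where the first steps differ, both remainders run to `r` without meeting `v`; together they
  -- join two neighbours of `v` away from `v`, which `away-cycle` excludes.
  path-unique : ∀ {v vs ws} → Path (Adj T) r v vs → Path (Adj T) r v ws → vs ≡ ws
  path-unique []            []            = refl
  path-unique []            (step _ q r∉) = contradiction (end∈ q) r∉
  path-unique (step _ p r∉) []            = contradiction (end∈ p) r∉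
  path-unique {v} (step {w = w} a p v∉) (step {w = w′} a′ p′ v∉′) with w Fin.≟ w′
  ... | yes refl = cong (w ∷_) (path-unique p p′)
  ... | no w≢w′  = ⊥-elim (away-cycle a a′ w≢w′
    (path-away p v∉ ◅◅ Star.reverse (λ (a , x≢ , y≢) → adj-sym a , y≢ , x≢) (path-away p′ v∉′)))

  trail : Fin n → List (Fin n)
  trail v = proj₁ (simplify (connected v r))

  trail-path : ∀ v → Path (Adj T) r v (trail v)
  trail-path v = proj₂ (simplify (connected v r))

  depth : Fin n → ℕ
  depth v = length (trail v)

  Parent : Fin n → Fin n → Set
  Parent w v = trail v ≡ w ∷ trail w

  -- Either `v` can be put in front of the trail of `w`, or it lies on that trail and uniqueness of
  -- paths makes it the first vertex after `w`.
  parent-or-child : ∀ {v w} → Adj T v w → Parent w v ⊎ Parent v w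
  parent-or-child {v} {w} a with ∈L? Fin._≟_ v (w ∷ trail w)
  ... | no v∉ = inj₁ (path-unique (trail-path v) (step a (trail-path w) v∉))
  ... | yes (here refl) = contradiction a (Graph.irrefl T v)
  ... | yes (there v∈) = inj₂ (child (trail-path w) refl v∈)
    where
    child : ∀ {ws} → Path (Adj T) r w ws → trail w ≡ ws → v ∈ ws → Parent v w
    child p@(step _ q w∉) eq v∈ with suffix q v∈
    ... | vs , q′ , vs⊆ = trans eq (trans (path-unique p (step (adj-sym a) q′ (λ w∈ → w∉ (vs⊆ w∈))))
                            (cong (v ∷_) (path-unique q′ (trail-path v))))

  parent-depth : ∀ {v w} → Parent w v → depth v ≡ suc (depth w)
  parent-depth = cong length

  parent-unique : ∀ {v w w′} → Parent w v → Parent w′ v → w ≡ w′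
  parent-unique p p′ = proj₁ (∷-injective (trans (sym p) p′))

  -- Tops of hyperedges

  data Descends (e : Subset n) (t : Fin n) : Fin n → Set where
    stop : Descends e t t
    down : ∀ {v w} → w ∈ₛ e → Descends e t w → Parent w v → Descends e t v

  descends-deeper : ∀ {e t v} → Descends e t v → v ≡ t ⊎ depth t < depth v
  descends-deeper stop = inj₁ refl
  descends-deeper (down _ d p) with descends-deeper d
  ... | inj₁ refl = inj₂ (ℕ.≤-reflexive (sym (parent-depth p)))
  ... | inj₂ lt   = inj₂ (ℕ.<-trans lt (ℕ.≤-reflexive (sym (parent-depth p))))

  Minimal : Subset n → Fin n → Set
  Minimal e t = ∀ u → u ∈ₛ e → depth t ≤ depth u

  -- Along a walk inside `e`, a step away from the root lengthens the descent. A step towards the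
  -- root undoes the last one, as parents are unique, and cannot leave `t`, as no vertex of `e` is
  -- less deep.
  descends : ∀ {e t u} → InducedConnected T e → t ∈ₛ e → Minimal e t → u ∈ₛ e → Descends e t u
  descends {e} {t} ic t∈ min u∈ = walk stop (ic t∈ u∈) u∈
    where
    walk : ∀ {v u} → Descends e t v → Star (λ a b → Adj T a b × a ∈ₛ e × b ∈ₛ e) v u → u ∈ₛ e → Descends e t u
    walk d ε u∈ = d
    walk {v} d (_◅_ {j = w} (a , v∈ , w∈) s) u∈ with parent-or-child a
    ... | inj₂ p = walk (down v∈ d p) s u∈
    ... | inj₁ p with d
    ...   | stop = contradiction (min w w∈) (ℕ.<⇒≱ (ℕ.≤-reflexive (sym (parent-depth p))))
    ...   | down _ d′ p′ with parent-unique p p′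
    ...     | refl = walk d′ s u∈

  minimum : ∀ (e : Subset n) u → u ∈ₛ e → ∀ k → depth u ≤ k → ∃[ t ] (t ∈ₛ e × Minimal e t)
  minimum e u u∈ k le with any? (λ v → (v ∈? e) ×-dec (depth v ℕ.<? depth u))
  ... | no none = u , u∈ , λ v v∈ → ℕ.≮⇒≥ (λ lt → none (v , v∈ , lt))
  minimum e u u∈ zero    le | yes (v , v∈ , lt) = contradiction (ℕ.≤-trans lt le) λ ()
  minimum e u u∈ (suc k) le | yes (v , v∈ , lt) = minimum e v v∈ k (ℕ.≤-pred (ℕ.≤-trans lt le))

  top : Subset n → Fin n
  top e with any? (_∈? e)
  ... | yes (u , u∈) = proj₁ (minimum e u u∈ (depth u) ℕ.≤-refl)
  -- An empty set has no top; the root is a default value.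
  ... | no _         = r

  top-minimal : ∀ {e u} → u ∈ₛ e → top e ∈ₛ e × Minimal e (top e)
  top-minimal {e} u∈ with any? (_∈? e)
  ... | yes (u , u∈′) = proj₂ (minimum e u u∈′ (depth u) ℕ.≤-refl)
  ... | no none       = contradiction (_ , u∈) none

  top-descends : ∀ {e u} → InducedConnected T e → u ∈ₛ e → Descends e (top e) u
  top-descends ic u∈ = descends ic (proj₁ (top-minimal u∈)) (proj₂ (top-minimal u∈)) u∈

  -- Off the tops, u and its parent would be two common vertices.
  meet-at-top : ∀ {e f u} → InducedConnected T e → InducedConnected T f →
    (∀ {u v} → u ∈ₛ e → u ∈ₛ f → v ∈ₛ e → v ∈ₛ f → u ≡ v) →
    depth (top e) ≤ depth (top f) → u ∈ₛ e → u ∈ₛ f → u ≡ top f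
  meet-at-top ice icf lin le u∈e u∈f with top-descends icf u∈f
  ... | stop = refl
  ... | d@(down {w = w} w∈f _ p) with descends-deeper d
  ...   | inj₁ u≡ = u≡
  ...   | inj₂ lt with top-descends ice u∈e
  ...     | stop = contradiction le (ℕ.<⇒≱ lt)
  ...     | down w∈e _ p′ with parent-unique p p′
  ...       | refl with lin u∈e u∈f w∈e w∈f
  ...         | refl = contradiction (parent-depth p) (ℕ.<⇒≢ (ℕ.n<1+n _))

-- Placements

-- side = true asks for edge = N⁻(site), side = false for edge = N⁺(site).
record Placed (n : ℕ) : Set where
  constructor placed
  field
    edge : Subset n
    side : Bool
    site : Maybe (Fin n)
open Placed

infix 4 _∈ᵐ_
_∈ᵐ_ : ∀ {n} → Maybe (Fin n) → Subset n → Set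
just v  ∈ᵐ e = v ∈ₛ e
nothing ∈ᵐ e = ⊥

Disjoint : ∀ {n} → Subset n → Subset n → Set
Disjoint e f = ∀ {u} → u ∈ₛ e → u ∈ₛ f → ⊥

fill : ∀ {n} → Fin n → Maybe (Fin n) → Maybe (Fin n)
fill b (just v) = just v
fill b nothing  = just b

-- `separate` compares the optional sites themselves, so a compatible list has at most one entry
-- without a site, and mapping this over it fills only that one.
fillAt : ∀ {n} → Fin n → Placed n → Placed n
fillAt b x = placed (edge x) (side x) (fill b (site x))

fill-∈ : ∀ {n} {b : Fin n} {e} m → b ∉ₛ e → fill b m ∈ᵐ e → m ∈ᵐ e
fill-∈ (just v) _   v∈e = v∈e
fill-∈ nothing  b∉e b∈e = b∉e b∈e

-- For x standing before y in a list, whose order is the order used for acyclicity; zs is the whole list.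
record Compat {n} (zs : List (Placed n)) (x y : Placed n) : Set where
  constructor mkCompat
  field
    edges≢ : edge x ≢ edge y
    separate : site x ≢ site y
    ordered  : side x ≡ side y → ¬ site x ∈ᵐ edge y
    linkedˡ  : side x ≢ side y → site x ∈ᵐ edge y → site y ∈ᵐ edge x
    linkedʳ  : side x ≢ side y → site y ∈ᵐ edge x → site x ∈ᵐ edge y
    shared   : side x ≡ side y → ∀ {c} → c ∈ₛ edge x → c ∈ₛ edge y →
               ∃[ z ] (z ∈ zs × side z ≢ side x × site z ≡ just c)
open Compat

-- The form in which every pair of a new and an old hyperedge is treated: neither link is present
-- and nothing is shared on one side, so the remaining conditions are vacuous.
apart : ∀ {n} {zs : List (Placed n)} {x y} → edge x ≢ edge y → site x ≢ site y →
  ¬ site x ∈ᵐ edge y → (side x ≢ side y → ¬ site y ∈ᵐ edge x) →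
  (side x ≡ side y → Disjoint (edge x) (edge y)) → Compat zs x y
apart e≢ s≢ x∉y y∉x dis = mkCompat e≢ s≢ (λ _ → x∉y) (λ _ p → ⊥-elim (x∉y p))
  (λ q p → ⊥-elim (y∉x q p)) (λ q c∈ c∈′ → ⊥-elim (dis q c∈ c∈′))

-- As `b` lies in neither hyperedge, filling creates no new membership, and as `b` was not a site of
-- either, the sites stay different.
fill-compat : ∀ {n} {zs zs′ : List (Placed n)} {b} x y → b ∉ₛ edge x → b ∉ₛ edge y →
  site x ≢ just b → site y ≢ just b →
  (∀ {z} → z ∈ zs → fillAt b z ∈ zs′) →
  Compat zs x y → Compat zs′ (fillAt b x) (fillAt b y)
fill-compat {zs′ = zs′} {b} x y b∉x b∉y x≢b y≢b zs⊆ c =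
  mkCompat (edges≢ c) (sep (site x) (site y) x≢b y≢b (separate c))
    (λ q p → ordered c q (fill-∈ (site x) b∉y p))
    (λ q p → keep (site y) (linkedˡ c q (fill-∈ (site x) b∉y p)))
    (λ q p → keep (site x) (linkedʳ c q (fill-∈ (site y) b∉x p)))
    (λ q p p′ → let z , z∈ , z≢ , eq = shared c q p p′ in
       fillAt b z , zs⊆ z∈ , z≢ , cong (fill b) eq)
  where
  keep : ∀ m {e} → m ∈ᵐ e → fill b m ∈ᵐ e
  keep (just _) p = p
  sep : ∀ m m′ → m ≢ just b → m′ ≢ just b → m ≢ m′ → fill b m ≢ fill b m′
  sep (just _) (just _) _   _   m≢ eq = m≢ eq
  sep (just _) nothing  m≢b _   _  eq = m≢b eq
  sep nothing  (just _) _   m≢b _  eq = m≢b (sym eq)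
  sep nothing  nothing  _   _   m≢ _  = m≢ refl

not-≢ : ∀ s → not s ≢ s
not-≢ true  ()
not-≢ false ()

≢not⇒≡ : ∀ {s t} → not s ≢ t → t ≡ s
≢not⇒≡ {true}  {true}  p = refl
≢not⇒≡ {true}  {false} p = contradiction refl p
≢not⇒≡ {false} {true}  p = contradiction refl p
≢not⇒≡ {false} {false} p = refl

map-edge-fillAt : ∀ {n} (b : Fin n) xs → map edge (map (fillAt b) xs) ≡ map edge xs
map-edge-fillAt b xs = sym (map-∘ xs)

AllPairs-map-∈ : ∀ {A : Set} {R S : A → A → Set} {xs} →
  (∀ {x y} → x ∈ xs → y ∈ xs → R x y → S x y) → AllPairs R xs → AllPairs S xs
AllPairs-map-∈ f []       = []
AllPairs-map-∈ f (r ∷ rs) = All.tabulate (λ y∈ → f (here refl) (there y∈) (All.lookup r y∈))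
                          ∷ AllPairs-map-∈ (λ x∈ y∈ → f (there x∈) (there y∈)) rs

AllPairs-++⁻ : ∀ {A : Set} {R : A → A → Set} xs {ys} → AllPairs R (xs ++ ys) →
  AllPairs R xs × AllPairs R ys × All (λ x → All (R x) ys) xs
AllPairs-++⁻ []       rs       = [] , rs , []
AllPairs-++⁻ (x ∷ xs) (r ∷ rs) =
  let p , q , c = AllPairs-++⁻ xs rs in All.++⁻ˡ xs r ∷ p , q , All.++⁻ʳ xs r ∷ c

-- Finding the centre of a star

Touch : ∀ {n} → Subset n → Subset n → Set
Touch g f = ∃[ u ] (u ∈ₛ g × u ∈ₛ f)

touch? : ∀ {n} (g f : Subset n) → Dec (Touch g f)
touch? g f = any? (λ u → (u ∈? g) ×-dec (u ∈? f))

record Centre {n} (es : List (Subset n)) : Set where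
  constructor mkCentre
  field
    before after : List (Subset n)
    centre leaf  : Subset n
    decompose    : es ≡ before ++ centre ∷ after
    disjoint     : AllPairs Disjoint after
    leaf∈        : leaf ∈ after
    touching     : Touch centre leaf

-- The search works from the end of the list, so the centre is the last hyperedge that meets a later
-- one; hence those after it are pairwise disjoint.
findCentre : ∀ {n} (es : List (Subset n)) → AllPairs Disjoint es ⊎ Centre es
findCentre []       = inj₁ []
findCentre (e ∷ es) with findCentre es
... | inj₂ (mkCentre B A g f eq d f∈ t) = inj₂ (mkCentre (e ∷ B) A g f (cong (e ∷_) eq) d f∈ t)
... | inj₁ d with Any.any? (touch? e) es
...   | yes t = let f , f∈ , t′ = find t in inj₂ (mkCentre [] es e f refl d f∈ t′)
...   | no ¬t = inj₁ (All.tabulate (λ f∈ u∈e u∈f → ¬t (lose f∈ (_ , u∈e , u∈f))) ∷ d)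

Complete : ∀ {n} → List (Placed n) → Set
Complete xs = ∀ {x} → x ∈ xs → site x ≢ nothing

does-true : ∀ {A : Set} (d : Dec A) → does d ≡ true → A
does-true (yes a) _ = a

-- Choosing vertices from large subsets

shrink : ∀ {n} (p : Subset n) x → ∃[ q ] ((∀ {z} → z ∈ₛ q → z ∈ₛ p × z ≢ x) × ∣ p ∣ ≤ suc ∣ q ∣)
shrink (true  ∷ p) Fin.zero = false ∷ p , (λ { (there z∈) → there z∈ , λ () }) , ℕ.≤-refl
shrink (false ∷ p) Fin.zero = false ∷ p , (λ { (there z∈) → there z∈ , λ () }) , ℕ.n≤1+n _
shrink (true  ∷ p) (Fin.suc x) = let q , h , le = shrink p x in
  true ∷ q , (λ { here → here , (λ ())
                ; (there z∈) → there (proj₁ (h z∈)) , λ { refl → proj₂ (h z∈) refl } }) , s≤s le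
shrink (false ∷ p) (Fin.suc x) = let q , h , le = shrink p x in
  false ∷ q , (λ { (there z∈) → there (proj₁ (h z∈)) , λ { refl → proj₂ (h z∈) refl } }) , le

size≥1 : ∀ {n} (p : Subset n) → 1 ≤ ∣ p ∣ → ∃[ z ] z ∈ₛ p
size≥1 {n} p le with nonempty? p
... | yes ne = ne
... | no  e  = contradiction (ℕ.≤-trans le (ℕ.≤-reflexive (trans (cong ∣_∣ (Empty-unique e)) (∣⊥∣≡0 n)))) λ ()

size≥2 : ∀ {n} (p : Subset n) → 2 ≤ ∣ p ∣ → ∃[ u ] ∃[ v ] (u ∈ₛ p × v ∈ₛ p × u ≢ v)
size≥2 p le with size≥1 p (ℕ.<⇒≤ le)
... | u , u∈ with shrink p u
...   | q , h , le′ with size≥1 q (ℕ.≤-pred (ℕ.≤-trans le le′))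
...     | v , v∈ = u , v , u∈ , proj₁ (h v∈) , ≢-sym (proj₂ (h v∈))

size≥3 : ∀ {n} (p : Subset n) → 3 ≤ ∣ p ∣ → ∀ x y → ∃[ z ] (z ∈ₛ p × z ≢ x × z ≢ y)
size≥3 p le x y with shrink p x
... | q , h , le₁ with shrink q y
...   | r , h′ , le₂ with size≥1 r (ℕ.≤-pred (ℕ.≤-trans (ℕ.≤-pred (ℕ.≤-trans le le₁)) le₂))
...     | z , z∈ = let z∈q , z≢y = h′ z∈ ; z∈p , z≢x = h z∈q in z , z∈p , z≢x , z≢y

-- Good placements and their extension

module Placing {n} (𝓔 : Subset n → Set)
  (linear : ∀ {e f u v} → 𝓔 e → 𝓔 f → e ≢ f → u ∈ₛ e → u ∈ₛ f → v ∈ₛ e → v ∈ₛ f → u ≡ v)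
  (degree≤2 : ∀ {e f g u} → 𝓔 e → 𝓔 f → 𝓔 g → e ≢ f → e ≢ g → f ≢ g →
              u ∈ₛ e → u ∈ₛ f → u ∈ₛ g → ⊥)
  (point : ∀ {e} → 𝓔 e → ∃[ z ] z ∈ₛ e)
  (third : ∀ {e} → 𝓔 e → ∀ x y → ∃[ z ] (z ∈ₛ e × z ≢ x × z ≢ y)) where

  -- `covered` keeps the sites inside the union of the placed hyperedges: a vertex outside it is not
  -- yet a site, and a hyperedge disjoint from it contains no site.
  record Good (xs : List (Placed n)) : Set where
    field
      compat  : AllPairs (Compat xs) xs
      outside : ∀ {x} → x ∈ xs → ¬ site x ∈ᵐ edge x
      covered : ∀ {x v} → x ∈ xs → site x ≡ just v → ∃[ y ] (y ∈ xs × v ∈ₛ edge y)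
      real    : ∀ {x} → x ∈ xs → 𝓔 (edge x)
  open Good

  Apart : Subset n → List (Placed n) → Set
  Apart e xs = ∀ {y} → y ∈ xs → Disjoint e (edge y)

  Unused : Fin n → List (Placed n) → Set
  Unused v xs = ∀ {y} → y ∈ xs → v ∉ₛ edge y

  unused-site : ∀ {xs v y} → Good xs → Unused v xs → y ∈ xs → site y ≢ just v
  unused-site G v∉ y∈ eq = let z , z∈ , v∈z = covered G y∈ eq in v∉ z∈ v∈z

  apart-site : ∀ {xs e y} → Good xs → Apart e xs → y ∈ xs → ¬ site y ∈ᵐ e
  apart-site {y = y} G dis y∈ p with site y in s
  ... | just w = let z , z∈ , w∈z = covered G y∈ s in dis z∈ p w∈z

  unused-filled : ∀ {xs v b y} → Good xs → Unused v xs → v ≢ b → y ∈ xs → just v ≢ fill b (site y)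
  unused-filled {y = y} G v∉ v≢b y∈ eq with site y in s
  ... | just w  = unused-site G v∉ y∈ (trans s (sym eq))
  ... | nothing = v≢b (just-injective eq)

  -- No old site lies in such an `e`, so the vertex found there is the one just filled in.
  apart-hole : ∀ {xs e b y} → Good xs → Apart e xs → y ∈ xs → fill b (site y) ∈ᵐ e → site y ≡ nothing
  apart-hole {y = y} G dis y∈ p with site y in s
  ... | nothing = refl
  ... | just w  = let z , z∈ , w∈z = covered G y∈ s in ⊥-elim (dis z∈ p w∈z)

  disjoint⇒≢ : ∀ {e f} → 𝓔 e → Disjoint e f → e ≢ f
  disjoint⇒≢ Ee dis refl = let z , z∈ = point Ee in dis z∈ z∈

  extend : ∀ {xs b} ns → Good xs → Unused b xs →
    (∃[ x ] (x ∈ ns × b ∈ₛ edge x)) →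
    AllPairs (Compat (ns ++ map (fillAt b) xs)) ns →
    (∀ {x y} → x ∈ ns → y ∈ xs → Compat (ns ++ map (fillAt b) xs) x (fillAt b y)) →
    (∀ {x} → x ∈ ns → ¬ site x ∈ᵐ edge x) →
    (∀ {x v} → x ∈ ns → site x ≡ just v → ∃[ y ] (y ∈ ns × v ∈ₛ edge y)) →
    (∀ {x} → x ∈ ns → 𝓔 (edge x)) →
    Good (ns ++ map (fillAt b) xs)
  extend {xs} {b} ns G b∉ (x₀ , x₀∈ , b∈x₀) new cross out cov re = record
    { compat  = AllPairs.++⁺ new (AllPairs.map⁺ (AllPairs-map-∈ old (compat G)))
                  (All.tabulate λ x∈ → All.map⁺ (All.tabulate λ y∈ → cross x∈ y∈))
    ; outside = λ x∈ → [ out , out′ ]′ (∈-++⁻ ns x∈)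
    ; covered = λ x∈ → [ cov′ , cov″ ]′ (∈-++⁻ ns x∈)
    ; real    = λ x∈ → [ re , re′ ]′ (∈-++⁻ ns x∈)
    }
    where
    fillAt∈ : ∀ {z} → z ∈ xs → fillAt b z ∈ ns ++ map (fillAt b) xs
    fillAt∈ z∈ = ∈-++⁺ʳ ns (∈-map⁺ (fillAt b) z∈)
    old : ∀ {x y} → x ∈ xs → y ∈ xs → Compat xs x y →
          Compat (ns ++ map (fillAt b) xs) (fillAt b x) (fillAt b y)
    old {x} {y} x∈ y∈ = fill-compat x y (b∉ x∈) (b∉ y∈) (unused-site G b∉ x∈) (unused-site G b∉ y∈) fillAt∈
    out′ : ∀ {x} → x ∈ map (fillAt b) xs → ¬ site x ∈ᵐ edge x
    out′ x∈ p with ∈-map⁻ (fillAt b) x∈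
    ... | y , y∈ , refl = outside G y∈ (fill-∈ (site y) (b∉ y∈) p)
    re′ : ∀ {x} → x ∈ map (fillAt b) xs → 𝓔 (edge x)
    re′ x∈ with ∈-map⁻ (fillAt b) x∈
    ... | y , y∈ , refl = real G y∈
    cov′ : ∀ {x v} → x ∈ ns → site x ≡ just v → ∃[ y ] (y ∈ ns ++ map (fillAt b) xs × v ∈ₛ edge y)
    cov′ x∈ eq = let y , y∈ , v∈ = cov x∈ eq in y , ∈-++⁺ˡ y∈ , v∈
    cov″ : ∀ {x v} → x ∈ map (fillAt b) xs → site x ≡ just v →
           ∃[ y ] (y ∈ ns ++ map (fillAt b) xs × v ∈ₛ edge y)
    cov″ x∈ eq with ∈-map⁻ (fillAt b) x∈
    ... | placed e s (just w) , y∈ , refl =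
      let z , z∈ , v∈ = covered G y∈ eq in fillAt b z , fillAt∈ z∈ , v∈
    ... | placed e s nothing  , y∈ , refl = x₀ , ∈-++⁺ˡ x₀∈ , subst (_∈ₛ edge x₀) (just-injective eq) b∈x₀

  -- What is needed to attach the centre g with side not s; a hole is a hyperedge still without a site.
  record Ready (g : Subset n) (s : Bool) (xs : List (Placed n)) : Set where
    field
      holes : ∀ {y} → y ∈ xs → site y ≡ nothing → side y ≡ s
      meets : ∀ {y u} → y ∈ xs → u ∈ₛ g → u ∈ₛ edge y → side y ≡ s
      sites : ∀ {y} → y ∈ xs → site y ∈ᵐ g → side y ≢ s
  open Ready

  -- `f` becomes the hole and gives the old hole its site. Both have side `s`, so the order allows
  -- this site because `f` stands in front.
  chain₁ : ∀ {xs g s f} → Good xs → Ready g s xs → 𝓔 g → 𝓔 f → g ≢ f → Apart f xs →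
    Σ (List (Placed n)) λ xs′ → Good xs′ × Ready g s xs′ × map edge xs′ ≡ f ∷ map edge xs
  chain₁ {xs} {g} {s} {f} G R Eg Ef g≢f dis =
    placed f s nothing ∷ map (fillAt b) xs
    , extend (placed f s nothing ∷ []) G b∉xs (_ , here refl , b∈f) ([] ∷ [])
        (λ { {_} {y} (here refl) y∈ → apart (disjoint⇒≢ Ef (dis y∈)) (nofill (site y)) (λ ())
               (λ s≢ p → s≢ (sym (holes R y∈ (apart-hole G dis y∈ p)))) (λ _ → dis y∈)
           ; (there ()) _ })
        (λ { (here refl) () ; (there ()) })
        (λ { (here refl) () ; (there ()) })
        (λ { (here refl) → Ef ; (there ()) })
    , record
      { holes = λ { (here refl) _ → refl ; (there y∈) → holes′ y∈ }
      ; meets = λ { (here refl) _ _ → refl ; (there y∈) → meets′ y∈ }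
      ; sites = λ { (here refl) () ; (there y∈) → sites′ y∈ } }
    , cong (f ∷_) (map-edge-fillAt b xs)
    where
    -- The filling vertex must avoid g: it becomes a site of the side that g is not going to have.
    exit : ∃[ b ] (b ∈ₛ f × b ∉ₛ g)
    exit with point Ef
    ... | z , z∈ with z ∈? g
    ...   | no z∉  = z , z∈ , z∉
    ...   | yes z∈g with third Ef z z
    ...     | w , w∈ , w≢ , _ = w , w∈ , λ w∈g → w≢ (linear Eg Ef g≢f w∈g w∈ z∈g z∈)
    b = proj₁ exit
    b∈f = proj₁ (proj₂ exit)
    b∉g = proj₂ (proj₂ exit)
    b∉xs : Unused b xs
    b∉xs y∈ b∈ = dis y∈ b∈f b∈
    nofill : ∀ m → nothing ≢ fill b m
    nofill (just _) ()
    nofill nothing  ()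
    holes′ : ∀ {y} → y ∈ map (fillAt b) xs → site y ≡ nothing → side y ≡ s
    holes′ y∈ eq with ∈-map⁻ (fillAt b) y∈
    ... | z , _ , refl = contradiction (sym eq) (nofill (site z))
    meets′ : ∀ {y u} → y ∈ map (fillAt b) xs → u ∈ₛ g → u ∈ₛ edge y → side y ≡ s
    meets′ y∈ p q with ∈-map⁻ (fillAt b) y∈
    ... | z , z∈ , refl = meets R z∈ p q
    sites′ : ∀ {y} → y ∈ map (fillAt b) xs → site y ∈ᵐ g → side y ≢ s
    sites′ y∈ p with ∈-map⁻ (fillAt b) y∈
    ... | z , z∈ , refl = sites R z∈ (fill-∈ (site z) b∉g p)

  chain : ∀ {xs g s} fs → Good xs → Ready g s xs → 𝓔 g →
    AllPairs Disjoint fs → (∀ {f} → f ∈ fs → 𝓔 f × g ≢ f × Apart f xs) →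
    Σ (List (Placed n)) λ xs′ → Good xs′ × Ready g s xs′ × map edge xs′ ≡ fs ++ map edge xs
  chain         []       G R Eg []       new = _ , G , R , refl
  chain {xs} {g} {s} (f ∷ fs) G R Eg (d ∷ ds) new
    with chain fs G R Eg ds (λ p → new (there p)) | new (here refl)
  ... | xs′ , G′ , R′ , eq | Ef , g≢f , dis with chain₁ G′ R′ Eg Ef g≢f dis′
    where
    dis′ : Apart f xs′
    dis′ {y} y∈ with ∈-++⁻ fs (subst (edge y ∈_) eq (∈-map⁺ edge y∈))
    ... | inj₁ p = All.lookup d p
    ... | inj₂ p with ∈-map⁻ edge p
    ...   | z , z∈ , e≡ = λ u∈ u∈′ → dis z∈ u∈ (subst (_ ∈ₛ_) e≡ u∈′)
  ...   | xs″ , G″ , R″ , eq′ = xs″ , G″ , R″ , trans eq′ (cong (f ∷_) eq)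

  -- Placing the centre of a star

  fillAt-complete : ∀ (b : Fin n) xs → Complete (map (fillAt b) xs)
  fillAt-complete b xs x∈ eq with ∈-map⁻ (fillAt b) x∈
  fillAt-complete b xs x∈ () | placed _ _ (just _) , _ , refl
  fillAt-complete b xs x∈ () | placed _ _ nothing  , _ , refl

  -- Besides the vertex `c` it shares with the centre, a hyperedge must supply two sites, one for
  -- the centre and one for the hole; this takes three vertices.
  twoMore : ∀ {f} → 𝓔 f → ∀ c → ∃[ a ] ∃[ b ] (a ∈ₛ f × b ∈ₛ f × a ≢ c × b ≢ c × a ≢ b)
  twoMore Ef c with third Ef c c
  ... | a , a∈ , a≢c , _ with third Ef c a
  ...   | b , b∈ , b≢c , b≢a = a , b , a∈ , b∈ , a≢c , b≢c , λ p → b≢a (sym p)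

  pair : ∀ {xs g s f c u} → Good xs → Ready g s xs → 𝓔 g → 𝓔 f → g ≢ f → Apart f xs →
    (∀ {y} → y ∈ xs → edge y ≢ g) →
    c ∈ₛ g → c ∈ₛ f → u ∈ₛ g → u ∉ₛ f → Unused u xs →
    Σ (List (Placed n)) λ xs′ → Good xs′ × Complete xs′ × map edge xs′ ≡ g ∷ f ∷ map edge xs
  pair {xs} {g} {s} {f} {c} {u} G R Eg Ef g≢f dis xs≢g c∈g c∈f u∈g u∉f u∉xs with twoMore Ef c
  ... | a , b , a∈f , b∈f , a≢c , b≢c , a≢b =
    _ , extend (x ∷ y ∷ []) G (unused b∈f) (_ , there (here refl) , b∈f)
          ((mkCompat g≢f (λ eq → u≢ a∈f (sym (just-injective eq))) (λ q → ⊥-elim (not-≢ s q))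
              (λ _ _ → u∈g) (λ _ _ → a∈f) (λ q → ⊥-elim (not-≢ s q)) ∷ []) ∷ [] ∷ [])
          (λ { {_} {z} (here refl) z∈ → apart (λ eq → xs≢g z∈ (sym eq)) (unused-filled G (unused a∈f) a≢b z∈)
                 (unused a∈f z∈)
                 (λ q p → sites R z∈ (fill-∈ (site z) (off-g b∈f b≢c) p) (≢not⇒≡ q))
                 (λ q {v} v∈g v∈z → not-≢ s (trans q (meets R {u = v} z∈ v∈g v∈z)))
             ; (there (here refl)) z∈ → apart (disjoint⇒≢ Ef (dis z∈)) (unused-filled G u∉xs (u≢ b∈f) z∈)
                 (u∉xs z∈) (λ q p → q (sym (holes R z∈ (apart-hole G dis z∈ p)))) (λ _ → dis z∈)
             ; (there (there ())) _ })
          (λ { (here refl) → off-g a∈f a≢c ; (there (here refl)) → u∉f ; (there (there ())) })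
          (λ { (here refl) refl → y , there (here refl) , a∈f
             ; (there (here refl)) refl → x , here refl , u∈g ; (there (there ())) })
          (λ { (here refl) → Eg ; (there (here refl)) → Ef ; (there (there ())) })
      , (λ { (here refl) () ; (there (here refl)) () ; (there (there z∈)) → fillAt-complete b xs z∈ })
      , cong (λ l → g ∷ f ∷ l) (map-edge-fillAt b xs)
    where
    x = placed g (not s) (just a)
    y = placed f s (just u)
    unused : ∀ {v} → v ∈ₛ f → Unused v xs
    unused v∈ z∈ v∈z = dis z∈ v∈ v∈z
    off-g : ∀ {v} → v ∈ₛ f → v ≢ c → v ∉ₛ g
    off-g v∈f v≢c v∈g = v≢c (linear Eg Ef g≢f v∈g v∈f c∈g c∈f)
    u≢ : ∀ {v} → v ∈ₛ f → u ≢ v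
    u≢ v∈ refl = u∉f v∈

  -- With `g` and `f₁` on one side, their common vertex `c₁` must be a site of the other side, and
  -- `f₂` takes it. This site lies in both `g` and `f₁`, so the links require their sites in `f₂`:
  -- these are `a` and `c₂`.
  triple : ∀ {xs g s f₁ f₂ c₁ c₂} → Good xs → Ready g s xs → 𝓔 g → 𝓔 f₁ → 𝓔 f₂ →
    g ≢ f₁ → g ≢ f₂ → Apart f₁ xs → Apart f₂ xs → Disjoint f₁ f₂ →
    (∀ {y} → y ∈ xs → edge y ≢ g) →
    c₁ ∈ₛ g → c₁ ∈ₛ f₁ → c₂ ∈ₛ g → c₂ ∈ₛ f₂ →
    Σ (List (Placed n)) λ xs′ → Good xs′ × Complete xs′ × map edge xs′ ≡ g ∷ f₁ ∷ f₂ ∷ map edge xs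
  triple {xs} {g} {s} {f₁} {f₂} {c₁} {c₂} G R Eg E₁ E₂ g≢f₁ g≢f₂ dis₁ dis₂ dis xs≢g c₁∈g c₁∈f₁ c₂∈g c₂∈f₂
    with twoMore E₂ c₂
  ... | a , b , a∈f₂ , b∈f₂ , a≢c₂ , b≢c₂ , a≢b =
    _ , extend (x ∷ y ∷ z ∷ []) G (unused b∈f₂) (z , there (there (here refl)) , b∈f₂)
          ((mkCompat g≢f₁ (λ eq → a≢c₂ (just-injective eq)) (λ _ → off-f₁ a∈f₂)
              (λ q → ⊥-elim (q refl)) (λ q → ⊥-elim (q refl))
              (λ _ c∈g c∈f₁ → z , there (there (here refl)) , ≢-sym (not-≢ s) ,
                 cong just (linear Eg E₁ g≢f₁ c₁∈g c₁∈f₁ c∈g c∈f₁))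
            ∷ mkCompat g≢f₂ (λ eq → off-f₁ a∈f₂ (subst (_∈ₛ f₁) (sym (just-injective eq)) c₁∈f₁))
              (λ q → ⊥-elim (not-≢ s q)) (λ _ _ → c₁∈g) (λ _ _ → a∈f₂) (λ q → ⊥-elim (not-≢ s q)) ∷ [])
          ∷ (mkCompat (disjoint⇒≢ E₁ dis) (λ eq → off-f₁ c₂∈f₂ (subst (_∈ₛ f₁) (sym (just-injective eq)) c₁∈f₁))
              (λ q → ⊥-elim (not-≢ s q)) (λ _ _ → c₁∈f₁) (λ _ _ → c₂∈f₂) (λ q → ⊥-elim (not-≢ s q)) ∷ [])
          ∷ [] ∷ [])
          (λ { {_} {w} (here refl) w∈ → apart (λ eq → xs≢g w∈ (sym eq)) (unused-filled G (unused a∈f₂) a≢b w∈)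
                 (unused a∈f₂ w∈)
                 (λ q p → sites R w∈ (fill-∈ (site w) (off-g b∈f₂ b≢c₂) p) (≢not⇒≡ q))
                 (λ q {v} v∈g v∈w → not-≢ s (trans q (meets R {u = v} w∈ v∈g v∈w)))
             ; {_} {w} (there (here refl)) w∈ → apart (disjoint⇒≢ E₁ (dis₁ w∈))
                 (unused-filled G (unused c₂∈f₂) (≢-sym b≢c₂) w∈) (unused c₂∈f₂ w∈)
                 (λ _ p → apart-site G dis₁ w∈ (fill-∈ (site w) (off-f₁ b∈f₂) p)) (λ _ → dis₁ w∈)
             ; (there (there (here refl))) w∈ → apart (disjoint⇒≢ E₂ (dis₂ w∈))
                 (unused-filled G (λ w∈ → dis₁ w∈ c₁∈f₁) (λ { refl → dis c₁∈f₁ b∈f₂ }) w∈) (dis₁ w∈ c₁∈f₁)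
                 (λ q p → q (sym (holes R w∈ (apart-hole G dis₂ w∈ p)))) (λ _ → dis₂ w∈)
             ; (there (there (there ()))) _ })
          (λ { (here refl) → off-g a∈f₂ a≢c₂ ; (there (here refl)) → off-f₁ c₂∈f₂
             ; (there (there (here refl))) → dis c₁∈f₁ ; (there (there (there ()))) })
          (λ { (here refl) refl → z , there (there (here refl)) , a∈f₂
             ; (there (here refl)) refl → x , here refl , c₂∈g
             ; (there (there (here refl))) refl → x , here refl , c₁∈g ; (there (there (there ()))) })
          (λ { (here refl) → Eg ; (there (here refl)) → E₁
             ; (there (there (here refl))) → E₂ ; (there (there (there ()))) })
      , (λ { (here refl) () ; (there (here refl)) () ; (there (there (here refl))) ()
           ; (there (there (there w∈))) → fillAt-complete b xs w∈ })
      , cong (λ l → g ∷ f₁ ∷ f₂ ∷ l) (map-edge-fillAt b xs)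
    where
    x = placed g (not s) (just a)
    y = placed f₁ (not s) (just c₂)
    z = placed f₂ s (just c₁)
    unused : ∀ {v} → v ∈ₛ f₂ → Unused v xs
    unused v∈ w∈ v∈w = dis₂ w∈ v∈ v∈w
    off-f₁ : ∀ {v} → v ∈ₛ f₂ → v ∉ₛ f₁
    off-f₁ v∈f₂ v∈f₁ = dis v∈f₁ v∈f₂
    off-g : ∀ {v} → v ∈ₛ f₂ → v ≢ c₂ → v ∉ₛ g
    off-g v∈f v≢c v∈g = v≢c (linear Eg E₂ g≢f₂ v∈g v∈f c₂∈g c₂∈f₂)

  -- Clearing the vertex of attachment

  Evicted : Subset n → Bool → Placed n → Set
  Evicted g s x = side x ≡ s × site x ∈ᵐ g

  evicted? : ∀ g s x → Dec (Evicted g s x)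
  evicted? g s x = (side x Bool.≟ s) ×-dec mem (site x)
    where
    mem : ∀ m → Dec (m ∈ᵐ g)
    mem (just v) = v ∈? g
    mem nothing  = no λ ()

  -- As `g` is going to have the side opposite to `s`, a site in `g` of a hyperedge of side `s`
  -- would require the site of `g` in that hyperedge; it is made a hole instead.
  evict : Subset n → Bool → Placed n → Placed n
  evict g s x with evicted? g s x
  ... | yes _ = placed (edge x) (side x) nothing
  ... | no  _ = x

  data EvictView (g : Subset n) (s : Bool) (x : Placed n) : Placed n → Set where
    gone : Evicted g s x → EvictView g s x (placed (edge x) (side x) nothing)
    kept : ¬ Evicted g s x → EvictView g s x x

  evictView : ∀ g s x → EvictView g s x (evict g s x)
  evictView g s x with evicted? g s x
  ... | yes p = gone p
  ... | no ¬p = kept ¬p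

  map-edge-evict : ∀ g s xs → map edge (map (evict g s) xs) ≡ map edge xs
  map-edge-evict g s xs = trans (sym (map-∘ xs)) (map-cong (λ x → same (evictView g s x)) xs)
    where
    same : ∀ {x x′} → EvictView g s x x′ → edge x′ ≡ edge x
    same (gone _) = refl
    same (kept _) = refl

  -- The placed hyperedges that meet `g` do so in one common vertex, and by the degree bound there
  -- is at most one of them; `s` is its side. A site in `g` is covered, so it is this vertex, and at
  -- most one hyperedge becomes a hole.
  vacate : ∀ {xs g} → Good xs → Complete xs → 𝓔 g → (∀ {y} → y ∈ xs → edge y ≢ g) →
    (∀ {y y′ u u′} → y ∈ xs → y′ ∈ xs → u ∈ₛ g → u ∈ₛ edge y → u′ ∈ₛ g → u′ ∈ₛ edge y′ → u ≡ u′) →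
    Σ (List (Placed n)) λ xs′ → Σ Bool λ s → Good xs′ × Ready g s xs′ × map edge xs′ ≡ map edge xs
  vacate {xs} {g} G C Eg xs≢g once = map (evict g s) xs , s
    , record { compat  = AllPairs.map⁺ (AllPairs-map-∈ compat′ (compat G))
             ; outside = out ; covered = cov ; real = re }
    , record { holes = holes′ ; meets = meets″ ; sites = sites′ }
    , map-edge-evict g s xs
    where
    touching? : Dec (Any.Any (λ y → ∃ λ u → u ∈ₛ g × u ∈ₛ edge y) xs)
    touching? = Any.any? (λ y → any? (λ u → (u ∈? g) ×-dec (u ∈? edge y))) xs
    chosen : Σ Bool λ s → ∀ {y u} → y ∈ xs → u ∈ₛ g → u ∈ₛ edge y → side y ≡ s
    chosen with touching?
    -- If no placed hyperedge meets `g`, either side will do.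
    ... | no ¬t = true , λ y∈ u∈g u∈y → contradiction (lose y∈ (_ , u∈g , u∈y)) ¬t
    ... | yes t with find t
    ...   | y₀ , y₀∈ , u₀ , u₀∈g , u₀∈y₀ = side y₀ , agree
      where
      agree : ∀ {y u} → y ∈ xs → u ∈ₛ g → u ∈ₛ edge y → side y ≡ side y₀
      agree {y} y∈ u∈g u∈y with ∈-AllPairs₂ (compat G) y∈ y₀∈ | once y∈ y₀∈ u∈g u∈y u₀∈g u₀∈y₀
      ... | inj₁ refl     | _    = refl
      ... | inj₂ (inj₁ c) | refl =
        ⊥-elim (degree≤2 (real G y∈) (real G y₀∈) Eg (edges≢ c) (xs≢g y∈) (xs≢g y₀∈) u∈y u₀∈y₀ u∈g)
      ... | inj₂ (inj₂ c) | refl =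
        ⊥-elim (degree≤2 (real G y₀∈) (real G y∈) Eg (edges≢ c) (xs≢g y₀∈) (xs≢g y∈) u₀∈y₀ u∈y u∈g)
    s = proj₁ chosen
    meets′ = proj₂ chosen
    located : ∀ {x} → x ∈ xs → site x ∈ᵐ g → ∃[ v ] ∃[ y ] (site x ≡ just v × v ∈ₛ g × y ∈ xs × v ∈ₛ edge y)
    located {x} x∈ p with site x in eq
    ... | just v = let y , y∈ , v∈ = covered G x∈ eq in v , y , refl , p , y∈ , v∈
    same-site : ∀ {x y} → x ∈ xs → y ∈ xs → site x ∈ᵐ g → site y ∈ᵐ g → site x ≡ site y
    same-site x∈ y∈ p q with located x∈ p | located y∈ q
    ... | v , z , eq , v∈g , z∈ , v∈z | v′ , z′ , eq′ , v′∈g , z′∈ , v′∈z′ =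
      trans eq (trans (cong just (once z∈ z′∈ v∈g v∈z v′∈g v′∈z′)) (sym eq′))
    -- A hyperedge through the evicted site meets `g` and so has side `s` too: eviction breaks no
    -- link.
    no-link : ∀ {x y} → y ∈ xs → Evicted g s x → side x ≢ side y → ¬ site x ∈ᵐ edge y
    no-link {placed _ _ (just v)} y∈ (q , v∈g) s≢ v∈y = s≢ (trans q (sym (meets′ y∈ v∈g v∈y)))
    evict∈ : ∀ {z} → z ∈ xs → evict g s z ∈ map (evict g s) xs
    evict∈ = ∈-map⁺ (evict g s)
    compat′ : ∀ {x y} → x ∈ xs → y ∈ xs → Compat xs x y →
      Compat (map (evict g s) xs) (evict g s x) (evict g s y)
    compat′ {x} {y} x∈ y∈ c = go (evictView g s x) (evictView g s y)
      where
      share : side x ≡ side y → ∀ {c} → c ∈ₛ edge x → c ∈ₛ edge y →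
              ∃[ z ] (z ∈ map (evict g s) xs × side z ≢ side x × site z ≡ just c)
      share q {v} v∈x v∈y with shared c q v∈x v∈y
      ... | z , z∈ , z≢ , eq = conclude (evictView g s z) (evict∈ z∈)
        where
        conclude : ∀ {z′} → EvictView g s z z′ → z′ ∈ map (evict g s) xs →
          ∃[ z ] (z ∈ map (evict g s) xs × side z ≢ side x × site z ≡ just v)
        conclude (kept _) z′∈ = z , z′∈ , z≢ , eq
        -- An evicted witness would have its site in `g`, and this vertex would lie in `g` and in
        -- both hyperedges.
        conclude (gone (_ , p)) _ = ⊥-elim (degree≤2 (real G x∈) (real G y∈) Eg (edges≢ c) (xs≢g x∈) (xs≢g y∈)
          v∈x v∈y (subst (_∈ᵐ g) eq p))
      go : ∀ {x′ y′} → EvictView g s x x′ → EvictView g s y y′ → Compat (map (evict g s) xs) x′ y′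
      go (kept _) (kept _) = mkCompat (edges≢ c) (separate c) (ordered c) (linkedˡ c) (linkedʳ c) share
      go (gone p) (kept _) = mkCompat (edges≢ c) (λ eq → C y∈ (sym eq)) (λ _ ()) (λ _ ())
        (λ q r → ⊥-elim (no-link {x} {y} y∈ p q (linkedʳ c q r))) share
      go (kept _) (gone p) = mkCompat (edges≢ c) (λ eq → C x∈ eq) (ordered c)
        (λ q r → ⊥-elim (no-link {y} {x} x∈ p (≢-sym q) (linkedˡ c q r))) (λ _ ()) share
      go (gone p) (gone q) = ⊥-elim (separate c (same-site x∈ y∈ (proj₂ p) (proj₂ q)))
    data Old : Placed n → Set where
      old : ∀ {x x′} → x ∈ xs → EvictView g s x x′ → Old x′
    from : ∀ {x} → x ∈ map (evict g s) xs → Old x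
    from x∈ with ∈-map⁻ (evict g s) x∈
    ... | x , x∈′ , refl = old x∈′ (evictView g s x)
    out : ∀ {x} → x ∈ map (evict g s) xs → ¬ site x ∈ᵐ edge x
    out x∈ p with from x∈
    ... | old y∈ (kept _) = outside G y∈ p
    cov : ∀ {x v} → x ∈ map (evict g s) xs → site x ≡ just v → ∃[ y ] (y ∈ map (evict g s) xs × v ∈ₛ edge y)
    cov {v = v} x∈ eq with from x∈
    ... | old y∈ (kept _) with covered G y∈ eq
    ...   | z , z∈ , v∈z = evict g s z , evict∈ z∈ , edge-of (evictView g s z)
      where
      edge-of : ∀ {z′} → EvictView g s z z′ → v ∈ₛ edge z′
      edge-of (gone _) = v∈z
      edge-of (kept _) = v∈z
    re : ∀ {x} → x ∈ map (evict g s) xs → 𝓔 (edge x)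
    re x∈ with from x∈
    ... | old y∈ (kept _) = real G y∈
    ... | old y∈ (gone _) = real G y∈
    holes′ : ∀ {y} → y ∈ map (evict g s) xs → site y ≡ nothing → side y ≡ s
    holes′ y∈ eq with from y∈
    ... | old x∈ (kept _) = contradiction eq (C x∈)
    ... | old x∈ (gone p) = proj₁ p
    meets″ : ∀ {y u} → y ∈ map (evict g s) xs → u ∈ₛ g → u ∈ₛ edge y → side y ≡ s
    meets″ y∈ p q with from y∈
    ... | old x∈ (kept _) = meets′ x∈ p q
    ... | old x∈ (gone _) = meets′ x∈ p q
    sites′ : ∀ {y} → y ∈ map (evict g s) xs → site y ∈ᵐ g → side y ≢ s
    sites′ y∈ p q with from y∈
    ... | old x∈ (kept ¬e) = ¬e (q , p)

  -- Lists of hyperedges up to order and repetition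

  _≟ₛ_ : (e f : Subset n) → Dec (e ≡ f)
  _≟ₛ_ = ≡-dec Bool._≟_

  without : Subset n → List (Subset n) → List (Subset n)
  without f = filter (λ e → ¬? (e ≟ₛ f))

  without-⊆ : ∀ f {K} → without f K ⊆ K
  without-⊆ f e∈ = proj₁ (∈-filter⁻ (λ e → ¬? (e ≟ₛ f)) e∈)

  split-off : ∀ f {K} → K ⊆ f ∷ without f K
  split-off f {K} {e} e∈ with e ≟ₛ f
  ... | yes refl = here refl
  ... | no e≢f   = there (∈-filter⁺ (λ e → ¬? (e ≟ₛ f)) e∈ e≢f)

  infix 4 _≋_
  _≋_ : List (Subset n) → List (Subset n) → Set
  es ≋ fs = es ⊆ fs × fs ⊆ es

  join : ∀ {e : Subset n} {es fs} → e ∈ fs → es ⊆ fs → e ∷ es ⊆ fs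
  join e∈ es⊆ (here refl) = e∈
  join e∈ es⊆ (there p)   = es⊆ p

  without-≢ : ∀ f K {e} → e ∈ without f K → e ≢ f
  without-≢ f K e∈ = proj₂ (∈-filter⁻ (λ e → ¬? (e ≟ₛ f)) {xs = K} e∈)

  regroup : ∀ g {es fs} hs → es ⊆ fs → fs ⊆ es → g ∷ es ++ hs ≋ g ∷ fs ++ hs
  regroup g hs p q = ⊆.∷⁺ʳ g (⊆.++⁺ˡ hs p) , ⊆.∷⁺ʳ g (⊆.++⁺ˡ hs q)

  transfer : (P : Subset n → Set) → ∀ {xs xs′} fs → map edge xs′ ≡ fs ++ map edge xs →
    (∀ {f} → f ∈ fs → P f) → (∀ {y} → y ∈ xs → P (edge y)) → ∀ {y} → y ∈ xs′ → P (edge y)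
  transfer P fs eq Pfs Pxs {y} y∈ with ∈-++⁻ fs (subst (edge y ∈_) eq (∈-map⁺ edge y∈))
  ... | inj₁ p = Pfs p
  ... | inj₂ p with ∈-map⁻ edge p
  ...   | z , z∈ , e≡ = subst P (sym e≡) (Pxs z∈)

  pairwise : ∀ {fs} {e f : Subset n} → AllPairs Disjoint fs → e ∈ fs → f ∈ fs → e ≢ f → Disjoint e f
  pairwise d e∈ f∈ e≢f with ∈-AllPairs₂ d e∈ f∈
  ... | inj₁ e≡f      = contradiction e≡f e≢f
  ... | inj₂ (inj₁ p) = p
  ... | inj₂ (inj₂ p) = λ u∈e u∈f → p u∈f u∈e

  -- By linearity `u` is not in `f₁`. If it is in no other member of `fs`, it can be the site of
  -- `f₁`, and `pair` applies; otherwise the member through `u` is the `f₂` of `triple`. The rest of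
  -- `fs` goes into the chain, whether or not it meets `g`.
  star : ∀ {xs g f₁ c₁ u} fs → Good xs → Complete xs → 𝓔 g → (∀ {y} → y ∈ xs → edge y ≢ g) →
    (∀ {y y′ u u′} → y ∈ xs → y′ ∈ xs → u ∈ₛ g → u ∈ₛ edge y → u′ ∈ₛ g → u′ ∈ₛ edge y′ → u ≡ u′) →
    AllPairs Disjoint fs → (∀ {f} → f ∈ fs → 𝓔 f × g ≢ f × Apart f xs) →
    f₁ ∈ fs → c₁ ∈ₛ g → c₁ ∈ₛ f₁ → u ∈ₛ g → u ≢ c₁ → Unused u xs →
    Σ (List (Placed n)) λ xs′ → Good xs′ × Complete xs′ × (map edge xs′ ≋ g ∷ fs ++ map edge xs)
  star {xs} {g} {f₁} {c₁} {u} fs G C Eg xs≢g once dfs new f₁∈ c₁∈g c₁∈f₁ u∈g u≢c₁ u∉xs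
    with vacate G C Eg xs≢g once | Any.any? (u ∈?_) (without f₁ fs)
  ... | xs₀ , s , G₀ , R₀ , eq₀ | no ¬f₂ =
    let xs₁ , G₁ , R₁ , eq₁ = chain rest G₀ R₀ Eg (AllPairs.filter⁺ _ dfs) (λ p → new₀ (without-⊆ f₁ p))
        eq = trans eq₁ (cong (rest ++_) eq₀)
        xs₂ , G₂ , C₂ , eq₂ = pair G₁ R₁ Eg E₁ g≢f₁
          (transfer (Disjoint f₁) rest eq (λ p → disjoint f₁∈ (without-⊆ f₁ p) (≢-sym (without-≢ f₁ fs p))) ap₁)
          (transfer (_≢ g) rest eq (λ p q → proj₁ (proj₂ (new (without-⊆ f₁ p))) (sym q)) xs≢g)
          c₁∈g c₁∈f₁ u∈g u∉f₁ (transfer (u ∉ₛ_) rest eq (λ p u∈f → ¬f₂ (lose p u∈f)) u∉xs)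
    in xs₂ , G₂ , C₂ , subst (_≋ g ∷ fs ++ map edge xs) (sym (trans eq₂ (cong (λ l → g ∷ f₁ ∷ l) eq)))
         (regroup g (map edge xs) (join f₁∈ (without-⊆ f₁)) (split-off f₁))
    where
    new₀ : ∀ {f} → f ∈ fs → 𝓔 f × g ≢ f × Apart f xs₀
    new₀ p = let Ef , g≢f , ap = new p in Ef , g≢f , transfer (Disjoint _) [] eq₀ (λ ()) ap
    rest = without f₁ fs
    disjoint : ∀ {e f} → e ∈ fs → f ∈ fs → e ≢ f → Disjoint e f
    disjoint = pairwise dfs
    E₁ = proj₁ (new f₁∈)
    g≢f₁ = proj₁ (proj₂ (new f₁∈))
    ap₁ = proj₂ (proj₂ (new f₁∈))
    u∉f₁ : u ∉ₛ f₁
    u∉f₁ u∈f₁ = u≢c₁ (linear Eg E₁ g≢f₁ u∈g u∈f₁ c₁∈g c₁∈f₁)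
  ... | xs₀ , s , G₀ , R₀ , eq₀ | yes t =
    let xs₁ , G₁ , R₁ , eq₁ = chain rest G₀ R₀ Eg (AllPairs.filter⁺ _ (AllPairs.filter⁺ _ dfs))
                                (λ p → new₀ (without-⊆ f₁ (without-⊆ f₂ p)))
        eq = trans eq₁ (cong (rest ++_) eq₀)
        xs₂ , G₂ , C₂ , eq₂ = triple G₁ R₁ Eg E₁ E₂ g≢f₁ g≢f₂
          (transfer (Disjoint f₁) rest eq
            (λ p → disjoint f₁∈ (rest⊆ p) (≢-sym (without-≢ f₁ fs (without-⊆ f₂ p)))) ap₁)
          (transfer (Disjoint f₂) rest eq
            (λ p → disjoint f₂∈ (rest⊆ p) (≢-sym (without-≢ f₂ (without f₁ fs) p))) ap₂)
          (disjoint f₁∈ f₂∈ (≢-sym (without-≢ f₁ fs f₂∈′)))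
          (transfer (_≢ g) rest eq (λ p q → proj₁ (proj₂ (new (rest⊆ p))) (sym q)) xs≢g)
          c₁∈g c₁∈f₁ u∈g u∈f₂
    in xs₂ , G₂ , C₂ , subst (_≋ g ∷ fs ++ map edge xs) (sym (trans eq₂ (cong (λ l → g ∷ f₁ ∷ f₂ ∷ l) eq)))
         (regroup g (map edge xs) (join f₁∈ (λ p → without-⊆ f₁ (join f₂∈′ (without-⊆ f₂) p)))
           (λ p → ⊆.∷⁺ʳ f₁ (split-off f₂) (split-off f₁ p)))
    where
    new₀ : ∀ {f} → f ∈ fs → 𝓔 f × g ≢ f × Apart f xs₀
    new₀ p = let Ef , g≢f , ap = new p in Ef , g≢f , transfer (Disjoint _) [] eq₀ (λ ()) ap
    f₂ = proj₁ (find t)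
    f₂∈′ = proj₁ (proj₂ (find t))
    u∈f₂ = proj₂ (proj₂ (find t))
    f₂∈ = without-⊆ f₁ f₂∈′
    rest = without f₂ (without f₁ fs)
    rest⊆ : rest ⊆ fs
    rest⊆ p = without-⊆ f₁ (without-⊆ f₂ p)
    disjoint : ∀ {e f} → e ∈ fs → f ∈ fs → e ≢ f → Disjoint e f
    disjoint = pairwise dfs
    E₁ = proj₁ (new f₁∈)
    g≢f₁ = proj₁ (proj₂ (new f₁∈))
    ap₁ = proj₂ (proj₂ (new f₁∈))
    E₂ = proj₁ (new f₂∈)
    g≢f₂ = proj₁ (proj₂ (new f₂∈))
    ap₂ = proj₂ (proj₂ (new f₂∈))

  -- Induction over stars

  Valid : List (Subset n) → Set
  Valid es = Σ (List (Placed n)) λ xs → Good xs × Complete xs × map edge xs ≋ es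

  ≋-trans : ∀ {es fs hs} → es ≋ fs → fs ≋ hs → es ≋ hs
  ≋-trans (p , q) (p′ , q′) = (λ e∈ → p′ (p e∈)) , (λ e∈ → q (q′ e∈))

  module _ (top : Subset n → Fin n) where

    Before : Subset n → Subset n → Set
    Before e f = e ≢ f × (∀ {u} → u ∈ₛ e → u ∈ₛ f → u ≡ top f)

    -- Splitting off the last centre `g` and the later hyperedges that meet it leaves a shorter
    -- sorted list. A pairwise disjoint list has no star to begin with; it is handed back, to be
    -- attached as a whole in the caller's star.
    place : ∀ k es → length es ≤ k → AllPairs Before es → (∀ {e} → e ∈ es → 𝓔 e) →
            AllPairs Disjoint es ⊎ Valid es
    place k es len bs re with findCentre es
    ... | inj₁ d = inj₁ d
    place zero    _ len bs re | inj₂ (mkCentre []      A g f refl d f∈ t) = contradiction len λ ()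
    place zero    _ len bs re | inj₂ (mkCentre (_ ∷ _) A g f refl d f∈ t) = contradiction len λ ()
    place (suc k) _ len bs re | inj₂ (mkCentre B A g f refl d f∈ (c , c∈g , c∈f)) =
      inj₂ (finish (place k H shorter sorted (λ e∈ → re (H⊆ e∈))))
      where
      M = filter (touch? g) A
      A′ = filter (λ e → ¬? (touch? g e)) A
      H = B ++ A′
      bsB = proj₁ (AllPairs-++⁻ B bs)
      bsA : AllPairs Before A
      bsA = AllPairs.tail (proj₁ (proj₂ (AllPairs-++⁻ B bs)))
      g<A : All (Before g) A
      g<A = AllPairs.head (proj₁ (proj₂ (AllPairs-++⁻ B bs)))
      B<gA : All (λ x → All (Before x) (g ∷ A)) B
      B<gA = proj₂ (proj₂ (AllPairs-++⁻ B bs))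
      shorter : length H ≤ k
      shorter = ℕ.≤-pred (ℕ.≤-trans (s≤s (ℕ.≤-trans (ℕ.≤-reflexive (length-++ B))
        (ℕ.+-monoʳ-≤ (length B) (length-filter _ A))))
        (ℕ.≤-trans (ℕ.≤-reflexive (trans (sym (ℕ.+-suc (length B) (length A))) (sym (length-++ B)))) len))
      sorted : AllPairs Before H
      sorted = AllPairs.++⁺ bsB (AllPairs.filter⁺ _ bsA) (All.map (λ { (_ ∷ r) → All.filter⁺ _ r }) B<gA)
      A′∈ : ∀ {e} → e ∈ A′ → e ∈ A × ¬ Touch g e
      A′∈ = ∈-filter⁻ (λ e → ¬? (touch? g e))
      M∈ : ∀ {e} → e ∈ M → e ∈ A × Touch g e
      M∈ = ∈-filter⁻ (touch? g)
      A⊆ : A ⊆ B ++ g ∷ A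
      A⊆ p = ∈-++⁺ʳ B (there p)
      H⊆ : H ⊆ B ++ g ∷ A
      H⊆ e∈ with ∈-++⁻ B e∈
      ... | inj₁ p = ∈-++⁺ˡ p
      ... | inj₂ p = A⊆ (proj₁ (A′∈ p))
      Eg : 𝓔 g
      Eg = re (∈-++⁺ʳ B (here refl))
      H≢g : ∀ {e} → e ∈ H → e ≢ g
      H≢g e∈ with ∈-++⁻ B e∈
      ... | inj₁ p = proj₁ (All.head (All.lookup B<gA p))
      ... | inj₂ p = ≢-sym (proj₁ (All.lookup g<A (proj₁ (A′∈ p))))
      H∩g : ∀ {e u} → e ∈ H → u ∈ₛ g → u ∈ₛ e → u ≡ top g
      H∩g e∈ u∈g u∈e with ∈-++⁻ B e∈
      ... | inj₁ p = proj₂ (All.head (All.lookup B<gA p)) u∈e u∈g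
      ... | inj₂ p = contradiction (_ , u∈g , u∈e) (proj₂ (A′∈ p))
      -- A hyperedge of `M` meets `g`, and likewise every element of `B`, only at its own top; if it
      -- met an element of `B`, its top would lie in three hyperedges.
      M∩H : ∀ {h e} → h ∈ M → e ∈ H → Disjoint h e
      M∩H h∈ e∈ u∈h u∈e with M∈ h∈ | ∈-++⁻ B e∈
      ... | h∈A , t | inj₂ p = pairwise d h∈A (proj₁ (A′∈ p)) (λ { refl → proj₂ (A′∈ p) t }) u∈h u∈e
      ... | h∈A , v , v∈g , v∈h | inj₁ p =
        degree≤2 Eg (re (A⊆ h∈A)) (re (∈-++⁺ˡ p)) (proj₁ (All.lookup g<A h∈A)) (≢-sym (H≢g e∈))
          (≢-sym (proj₁ e<h)) (subst (_∈ₛ g) v≡u v∈g) u∈h u∈e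
        where
        e<h = All.lookup (All.tail (All.lookup B<gA p)) h∈A
        v≡u = trans (proj₂ (All.lookup g<A h∈A) v∈g v∈h) (sym (proj₂ e<h u∈e u∈h))
      whole : g ∷ M ++ H ≋ B ++ g ∷ A
      whole = join (∈-++⁺ʳ B (here refl)) (λ e∈ → [ (λ p → A⊆ (proj₁ (M∈ p))) , H⊆ ]′ (∈-++⁻ M e∈)) , back
        where
        back : B ++ g ∷ A ⊆ g ∷ M ++ H
        back {e} e∈ with ∈-++⁻ B e∈
        ... | inj₁ p           = there (∈-++⁺ʳ M (∈-++⁺ˡ p))
        ... | inj₂ (here e≡g)  = here e≡g
        ... | inj₂ (there p) with touch? g e
        ...   | yes t = there (∈-++⁺ˡ (∈-filter⁺ (touch? g) p t))
        ...   | no ¬t = there (∈-++⁺ʳ M (∈-++⁺ʳ B (∈-filter⁺ (λ e → ¬? (touch? g e)) p ¬t)))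
      f∈M : f ∈ M
      f∈M = ∈-filter⁺ (touch? g) f∈ (c , c∈g , c∈f)
      new : ∀ {h} → h ∈ M → 𝓔 h × g ≢ h
      new h∈ = re (A⊆ (proj₁ (M∈ h∈))) , proj₁ (All.lookup g<A (proj₁ (M∈ h∈)))
      finish : AllPairs Disjoint H ⊎ Valid H → Valid (B ++ g ∷ A)
      -- Nothing is placed yet: `M` and the disjoint remainder are attached together to the first
      -- centre.
      finish (inj₁ dH) with third Eg (top g) c
      ... | u , u∈g , u≢top , u≢c =
        let xs , G , C , eq = star (M ++ H)
              (record { compat = [] ; outside = λ () ; covered = λ () ; real = λ () }) (λ ()) Eg (λ ()) (λ ())
              (AllPairs.++⁺ (AllPairs.filter⁺ _ d) dH
                (All.tabulate λ h∈ → All.tabulate λ e∈ {u} → M∩H h∈ e∈ {u}))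
              (λ p → [ (λ q → proj₁ (new q) , proj₂ (new q) , λ ())
                     , (λ q → re (H⊆ q) , ≢-sym (H≢g q) , λ ()) ]′ (∈-++⁻ M p))
              (∈-++⁺ˡ f∈M) c∈g c∈f u∈g u≢c (λ ())
        in xs , G , C , ≋-trans eq (subst (λ l → g ∷ l ≋ B ++ g ∷ A) (sym (++-identityʳ (M ++ H))) whole)
      finish (inj₂ (xs , G , C , eq)) with third Eg (top g) c
      ... | u , u∈g , u≢top , u≢c =
        let inH : ∀ {y} → y ∈ xs → edge y ∈ H
            inH y∈ = proj₁ eq (∈-map⁺ edge y∈)
            xs′ , G′ , C′ , eq′ = star M G C Eg (λ y∈ → H≢g (inH y∈))
              (λ y∈ y′∈ p q p′ q′ → trans (H∩g (inH y∈) p q) (sym (H∩g (inH y′∈) p′ q′)))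
              (AllPairs.filter⁺ _ d)
              (λ h∈ → proj₁ (new h∈) , proj₂ (new h∈) , λ y∈ → M∩H h∈ (inH y∈))
              f∈M c∈g c∈f u∈g u≢c (λ y∈ u∈y → u≢top (H∩g (inH y∈) u∈g u∈y))
        in xs′ , G′ , C′ , ≋-trans eq′ (≋-trans
             (⊆.++⁺ʳ (g ∷ M) (proj₁ eq) , ⊆.++⁺ʳ (g ∷ M) (proj₂ eq)) whole)

  -- The digraph of a placement

  module Realise {xs : List (Placed n)} (G : Good xs) (C : Complete xs) where

    -- The arc forced by such a hyperedge runs from `u` to `v` if `s` is `true`, and from `v` to `u`
    -- if `s` is `false`.
    Joins : Bool → Fin n → Fin n → Set
    Joins s u v = Any.Any (λ x → side x ≡ s × u ∈ₛ edge x × site x ≡ just v) xs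

    joins? : ∀ s u v → Dec (Joins s u v)
    joins? s u v = Any.any? (λ x → (side x Bool.≟ s) ×-dec ((u ∈? edge x) ×-dec ≡ᵐ-dec Fin._≟_ (site x) (just v))) xs

    -- Nbr true v is the in-neighbourhood of v and Nbr false v its out-neighbourhood.
    Nbr : Bool → Fin n → Fin n → Set
    Nbr s v u = Joins s u v ⊎ Joins (not s) v u

    nbr? : ∀ s v u → Dec (Nbr s v u)
    nbr? s v u = joins? s u v ⊎-dec joins? (not s) v u

    same-site : ∀ {x y} → x ∈ xs → y ∈ xs → site x ≡ site y → x ≡ y
    same-site x∈ y∈ eq with ∈-AllPairs₂ (compat G) x∈ y∈
    ... | inj₁ x≡y      = x≡y
    ... | inj₂ (inj₁ c) = contradiction eq (separate c)
    ... | inj₂ (inj₂ c) = contradiction (sym eq) (separate c)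

    linked : ∀ {x y} → x ∈ xs → y ∈ xs → side x ≢ side y → site x ∈ᵐ edge y → site y ∈ᵐ edge x
    linked x∈ y∈ s≢ p with ∈-AllPairs₂ (compat G) x∈ y∈
    ... | inj₁ refl     = contradiction refl s≢
    ... | inj₂ (inj₁ c) = linkedˡ c s≢ p
    ... | inj₂ (inj₂ c) = linkedʳ c (≢-sym s≢) p

    -- A neighbour comes from `x` itself, as sites are distinct, or is the site of a hyperedge of
    -- the other side through `v`; the link then puts it in `edge x`.
    nbr⇒edge : ∀ {x u v} → x ∈ xs → site x ≡ just v → Nbr (side x) v u → u ∈ₛ edge x
    nbr⇒edge x∈ eq (inj₁ j) with find j
    ... | y , y∈ , _ , u∈y , eq′ with same-site y∈ x∈ (trans eq′ (sym eq))
    ...   | refl = u∈y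
    nbr⇒edge {x} x∈ eq (inj₂ j) with find j
    ... | y , y∈ , s≡ , v∈y , eq′ =
      subst (_∈ᵐ edge x) eq′ (linked x∈ y∈ (λ q → not-≢ (side x) (sym (trans q s≡))) (subst (_∈ᵐ edge y) (sym eq) v∈y))

    edge⇒nbr : ∀ {x u v} → x ∈ xs → site x ≡ just v → u ∈ₛ edge x → Nbr (side x) v u
    edge⇒nbr x∈ eq u∈x = inj₁ (lose x∈ (refl , u∈x , eq))

    -- Each such neighbour is the site of a hyperedge of the other side through `v`. Two of these
    -- hyperedges would share `v`, and `shared` would make `v` a site of side `s`. So no unwanted
    -- hyperedge arises.
    nbr-unique : ∀ {s v u u′} → (∀ {x} → x ∈ xs → side x ≡ s → site x ≢ just v) →
      Nbr s v u → Nbr s v u′ → u ≡ u′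
    nbr-unique none (inj₁ j) _ = let x , x∈ , s≡ , _ , eq = find j in contradiction eq (none x∈ s≡)
    nbr-unique none (inj₂ _) (inj₁ j) = let x , x∈ , s≡ , _ , eq = find j in contradiction eq (none x∈ s≡)
    nbr-unique none (inj₂ j) (inj₂ j′) with find j | find j′
    ... | x , x∈ , s≡ , v∈x , eq | y , y∈ , s≡′ , v∈y , eq′ with ∈-AllPairs₂ (compat G) x∈ y∈
    ...   | inj₁ refl = just-injective (trans (sym eq) eq′)
    ...   | inj₂ (inj₁ c) = let z , z∈ , z≢ , eqz = shared c (trans s≡ (sym s≡′)) v∈x v∈y in
      contradiction eqz (none z∈ (≢not⇒≡ λ q → z≢ (trans (sym q) (sym s≡))))
    ...   | inj₂ (inj₂ c) = let z , z∈ , z≢ , eqz = shared c (trans s≡′ (sym s≡)) v∈y v∈x in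
      contradiction eqz (none z∈ (≢not⇒≡ λ q → z≢ (trans (sym q) (sym s≡′))))

    placed-site : ∀ {x} → x ∈ xs → ∃[ v ] site x ≡ just v
    placed-site {placed _ _ (just v)} x∈ = v , refl
    placed-site {placed _ _ nothing}  x∈ = contradiction refl (C x∈)

    Neighbourhood : Bool → Fin n → Subset n → Set
    Neighbourhood s v S = ∀ u → (u ∈ₛ S → Nbr s v u) × (Nbr s v u → u ∈ₛ S)

    neighbourhood-edge : ∀ {x v S} → x ∈ xs → site x ≡ just v → Neighbourhood (side x) v S → edge x ≡ S
    neighbourhood-edge x∈ eq N =
      ⊆-antisym (λ u∈ → proj₂ (N _) (edge⇒nbr x∈ eq u∈)) (λ u∈ → nbr⇒edge x∈ eq (proj₁ (N _) u∈))

    large-neighbourhood : ∀ {s v S u u′} → Neighbourhood s v S → u ∈ₛ S → u′ ∈ₛ S → u ≢ u′ → S ∈ map edge xs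
    large-neighbourhood {s} {v} N u∈ u′∈ u≢u′
      with Any.any? (λ x → (side x Bool.≟ s) ×-dec ≡ᵐ-dec Fin._≟_ (site x) (just v)) xs
    ... | no none = contradiction
      (nbr-unique (λ x∈ q eq → none (lose x∈ (q , eq))) (proj₁ (N _) u∈) (proj₁ (N _) u′∈)) u≢u′
    ... | yes some with find some
    ...   | x , x∈ , refl , eq = subst (_∈ map edge xs) (neighbourhood-edge x∈ eq N) (∈-map⁺ edge x∈)

    -- Two levels per hyperedge: one above the values of the tail, for a site of side `true`, and
    -- one below them, for a site of side `false`.
    height : List (Placed n) → ℕ
    height []       = 0
    height (x ∷ ys) = suc (suc (height ys))

    -- In the order of increasing φ the sites of side false come first, then the vertices
    -- that are not sites, then the sites of side true in the reverse of the list order.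
    φ : List (Placed n) → Fin n → ℕ
    φ []       v = 0
    φ (x ∷ ys) v with ≡ᵐ-dec Fin._≟_ (site x) (just v) | side x
    ... | yes _ | true  = suc (suc (height ys))
    ... | yes _ | false = 0
    ... | no _  | _     = suc (φ ys v)

    φ≤height : ∀ ys v → φ ys v ≤ height ys
    φ≤height []       v = z≤n
    φ≤height (x ∷ ys) v with ≡ᵐ-dec Fin._≟_ (site x) (just v) | side x
    ... | yes _ | true  = ℕ.≤-refl
    ... | yes _ | false = z≤n
    ... | no _  | _     = s≤s (ℕ.m≤n⇒m≤1+n (φ≤height ys v))

    -- Before `y`, no hyperedge has site `v`, by `separate`, and one with site `u` has side `false`,
    -- by `ordered`, which puts `u` at the bottom. Failing that, `y` puts `v` on top.
    rise-true : ∀ {ys y u v} → AllPairs (Compat xs) ys → (∀ {y} → y ∈ ys → ¬ site y ∈ᵐ edge y) →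
      y ∈ ys → side y ≡ true → u ∈ₛ edge y → site y ≡ just v → φ ys u < φ ys v
    rise-true {x ∷ ys} {y} {u} {v} (c ∷ cs) out y∈ q u∈y eq
      with ≡ᵐ-dec Fin._≟_ (site x) (just u) | ≡ᵐ-dec Fin._≟_ (site x) (just v) | side x in r
    rise-true (c ∷ cs) out (here refl) q u∈y eq | yes eu | _ | _ =
      contradiction (subst (_∈ᵐ _) (sym eu) u∈y) (out (here refl))
    rise-true (c ∷ cs) out (here refl) q u∈y eq | no _ | no ev | _ = contradiction eq ev
    rise-true {x ∷ ys} {u = u} (c ∷ cs) out (here refl) q u∈y eq | no _ | yes _ | true =
      s≤s (s≤s (φ≤height ys u))
    rise-true (c ∷ cs) out (here refl) q u∈y eq | no _ | yes _ | false = contradiction (trans (sym r) q) λ ()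
    rise-true (c ∷ cs) out (there y∈) q u∈y eq | _ | yes ev | _ =
      contradiction (trans ev (sym eq)) (separate (All.lookup c y∈))
    rise-true (c ∷ cs) out (there y∈) q u∈y eq | yes eu | no _ | true =
      contradiction (subst (_∈ᵐ _) (sym eu) u∈y) (ordered (All.lookup c y∈) (trans r (sym q)))
    rise-true (c ∷ cs) out (there y∈) q u∈y eq | yes eu | no _ | false = s≤s z≤n
    rise-true (c ∷ cs) out (there y∈) q u∈y eq | no _ | no _ | _ =
      s≤s (rise-true cs (λ p → out (there p)) y∈ q u∈y eq)

    -- The same with the ends exchanged: an earlier hyperedge with site `u` has side `true` and puts
    -- `u` on top; failing that, `y` puts `v` at the bottom.
    rise-false : ∀ {ys y u v} → AllPairs (Compat xs) ys → (∀ {y} → y ∈ ys → ¬ site y ∈ᵐ edge y) →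
      y ∈ ys → side y ≡ false → u ∈ₛ edge y → site y ≡ just v → φ ys v < φ ys u
    rise-false {x ∷ ys} {y} {u} {v} (c ∷ cs) out y∈ q u∈y eq
      with ≡ᵐ-dec Fin._≟_ (site x) (just u) | ≡ᵐ-dec Fin._≟_ (site x) (just v) | side x in r
    rise-false (c ∷ cs) out (here refl) q u∈y eq | yes eu | _ | _ =
      contradiction (subst (_∈ᵐ _) (sym eu) u∈y) (out (here refl))
    rise-false (c ∷ cs) out (here refl) q u∈y eq | no _ | no ev | _ = contradiction eq ev
    rise-false (c ∷ cs) out (here refl) q u∈y eq | no _ | yes _ | false = s≤s z≤n
    rise-false (c ∷ cs) out (here refl) q u∈y eq | no _ | yes _ | true = contradiction (trans (sym r) q) λ ()
    rise-false (c ∷ cs) out (there y∈) q u∈y eq | _ | yes ev | _ =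
      contradiction (trans ev (sym eq)) (separate (All.lookup c y∈))
    rise-false (c ∷ cs) out (there y∈) q u∈y eq | yes eu | no _ | false =
      contradiction (subst (_∈ᵐ _) (sym eu) u∈y) (ordered (All.lookup c y∈) (trans r (sym q)))
    rise-false {x ∷ ys} {v = v} (c ∷ cs) out (there y∈) q u∈y eq | yes eu | no _ | true =
      s≤s (s≤s (φ≤height ys v))
    rise-false (c ∷ cs) out (there y∈) q u∈y eq | no _ | no _ | _ =
      s≤s (rise-false cs (λ p → out (there p)) y∈ q u∈y eq)

    arc-rises : ∀ {u v} → Nbr true v u → φ xs u < φ xs v
    arc-rises (inj₁ j) with find j
    ... | y , y∈ , q , u∈y , eq = rise-true (compat G) (outside G) y∈ q u∈y eq
    arc-rises (inj₂ j) with find j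
    ... | y , y∈ , q , v∈y , eq = rise-false (compat G) (outside G) y∈ q v∈y eq

    -- The digraph and its neighbourhoods

    isArc : Fin n → Fin n → Bool
    isArc u v = does (nbr? true v u)

    isArc⇒nbr : ∀ {u v} → isArc u v ≡ true → Nbr true v u
    isArc⇒nbr {u} {v} = does-true (nbr? true v u)

    nbr⇒isArc : ∀ {u v} → Nbr true v u → isArc u v ≡ true
    nbr⇒isArc {u} {v} = dec-true (nbr? true v u)

    digraph : Digraph n
    digraph = record
      { arc    = isArc
      ; noOpp  = λ u v p q → ℕ.<-asym (arc-rises (isArc⇒nbr p)) (arc-rises (isArc⇒nbr q))
      ; noLoop = λ v p → ℕ.<-irrefl refl (arc-rises (isArc⇒nbr p))
      }

    acyclic : Acyclic digraph
    acyclic v p = ℕ.<-irrefl refl (rises p)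
      where
      rises : ∀ {u v} → TransClosure (Arc digraph) u v → φ xs u < φ xs v
      rises [ a ]   = arc-rises (isArc⇒nbr a)
      rises (a ∷⁺ p) = ℕ.<-trans (arc-rises (isArc⇒nbr a)) (rises p)

    ∈-tabulate : ∀ {f : Fin n → Bool} u → (u ∈ₛ tabulate f → f u ≡ true) × (f u ≡ true → u ∈ₛ tabulate f)
    ∈-tabulate {f} u = (λ p → trans (sym (lookup∘tabulate f u)) ([]=⇒lookup p))
                     , (λ p → lookup⇒[]= u _ (trans (lookup∘tabulate f u) p))

    in-neighbourhood : ∀ v → Neighbourhood true v (N⁻ digraph v)
    in-neighbourhood v u = (λ p → isArc⇒nbr (proj₁ (∈-tabulate u) p)) , (λ p → proj₂ (∈-tabulate u) (nbr⇒isArc p))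

    out-neighbourhood : ∀ v → Neighbourhood false v (N⁺ digraph v)
    out-neighbourhood v u = (λ p → Sum.swap (isArc⇒nbr (proj₁ (∈-tabulate u) p)))
                          , (λ p → proj₂ (∈-tabulate u) (nbr⇒isArc (Sum.swap p)))

    niche⇒edge : ∀ {S} → NicheEdge digraph S → S ∈ map edge xs
    niche⇒edge {S} (two≤ , v , d) with size≥2 S two≤
    ... | u , u′ , u∈ , u′∈ , u≢u′ with d
    ...   | inj₁ refl = large-neighbourhood (in-neighbourhood v) u∈ u′∈ u≢u′
    ...   | inj₂ refl = large-neighbourhood (out-neighbourhood v) u∈ u′∈ u≢u′

    edge⇒neighbourhood : ∀ {S} → S ∈ map edge xs → ∃[ v ] (S ≡ N⁻ digraph v ⊎ S ≡ N⁺ digraph v)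
    edge⇒neighbourhood S∈ with ∈-map⁻ edge S∈
    ... | x@(placed _ true _)  , x∈ , refl = let v , eq = placed-site x∈ in
      v , inj₁ (neighbourhood-edge x∈ eq (in-neighbourhood v))
    ... | x@(placed _ false _) , x∈ , refl = let v , eq = placed-site x∈ in
      v , inj₂ (neighbourhood-edge x∈ eq (out-neighbourhood v))

-- Application to linear hypertrees

card≤1⇒unique : ∀ {n} {p : Subset n} {u v} → ∣ p ∣ ≤ 1 → u ∈ₛ p → v ∈ₛ p → u ≡ v
card≤1⇒unique {p = p} {u} {v} le u∈ v∈ with u Fin.≟ v
... | yes u≡v = u≡v
... | no u≢v  = contradiction (ℕ.≤-trans two≤ le) λ { (s≤s ()) }
  where
  two≤ : 2 ≤ ∣ p ∣
  two≤ = subst (_< ∣ p ∣) (∣⁅x⁆∣≡1 u)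
    (p⊂q⇒∣p∣<∣q∣ ((λ z∈ → subst (_∈ₛ p) (sym (x∈⁅y⁆⇒x≡y u z∈)) u∈) , v , v∈ , λ v∈u → u≢v (sym (x∈⁅y⁆⇒x≡y u v∈u))))

short-list : ∀ {A : Set} {x y z : A} xs → length xs ≤ 2 → x ∈ xs → y ∈ xs → z ∈ xs →
  x ≢ y → x ≢ z → y ≢ z → ⊥
short-list (_ ∷ _ ∷ _ ∷ _) (s≤s (s≤s ()))
short-list _ _ (here refl) (here refl) _ x≢y _ _ = x≢y refl
short-list _ _ (here refl) _ (here refl) _ x≢z _ = x≢z refl
short-list _ _ _ (here refl) (here refl) _ _ y≢z = y≢z refl
short-list (_ ∷ _ ∷ []) _ (there (here refl)) (there (here refl)) _ x≢y _ _ = x≢y refl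
short-list (_ ∷ _ ∷ []) _ (there (here refl)) _ (there (here refl)) _ x≢z _ = x≢z refl
short-list (_ ∷ _ ∷ []) _ _ (there (here refl)) (there (here refl)) _ _ y≢z = y≢z refl

distinct-pair : ∀ {A : Set} {xs : List A} → length xs ≡ 2 → Unique xs →
  ∃[ x ] ∃[ y ] (x ∈ xs × y ∈ xs × x ≢ y)
distinct-pair {xs = x ∷ y ∷ []} refl ((x≢y ∷ []) ∷ _) = x , y , here refl , there (here refl) , x≢y

theorem1p2 : (H : Hypergraph) → Linear H → IsHypertree H → MaxDegree H 2 → AntiRank H 3 →
    Σ (Digraph (n H)) λ D → Acyclic D × IsNicheHypergraphOf H D
theorem1p2 H lin (T , (connected , no-cycle) , induced) (deg , v₀ , deg₀) (large , _) =
  conclude (place top (length es) es ℕ.≤-refl before toE)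
  where
  open Rooted T connected no-cycle v₀

  linear : ∀ {e f u v} → e ∈ E H → f ∈ E H → e ≢ f → u ∈ₛ e → u ∈ₛ f → v ∈ₛ e → v ∈ₛ f → u ≡ v
  linear e∈ f∈ e≢f p q p′ q′ = card≤1⇒unique (lin e∈ f∈ e≢f) (x∈p∩q⁺ (p , q)) (x∈p∩q⁺ (p′ , q′))

  degree≤2 : ∀ {e f g u} → e ∈ E H → f ∈ E H → g ∈ E H → e ≢ f → e ≢ g → f ≢ g →
             u ∈ₛ e → u ∈ₛ f → u ∈ₛ g → ⊥
  degree≤2 {u = u} e∈ f∈ g∈ e≢f e≢g f≢g p q r = short-list _ (deg u)
    (∈-filter⁺ (u ∈?_) e∈ p) (∈-filter⁺ (u ∈?_) f∈ q) (∈-filter⁺ (u ∈?_) g∈ r) e≢f e≢g f≢g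

  open Placing (_∈ E H) linear degree≤2
    (λ {e} e∈ → size≥1 e (ℕ.≤-trans (s≤s z≤n) (large e∈))) (λ {e} e∈ → size≥3 e (large e∈))

  byDepth : DecTotalOrder _ _ _
  byDepth = On.decTotalOrder ℕ.≤-decTotalOrder (λ e → depth (top e))
  open Sort byDepth using (sort; sort-↭; sort-↗)

  es = sort (E H)

  toE : ∀ {e} → e ∈ es → e ∈ E H
  toE = ∈-resp-↭ (sort-↭ (E H))

  fromE : ∀ {e} → e ∈ E H → e ∈ es
  fromE = ∈-resp-↭ (↭-sym (sort-↭ (E H)))

  before : AllPairs (Before top) es
  before = AllPairs-map-∈
    (λ e∈ f∈ (e≢f , le) → e≢f , meet-at-top (induced (toE e∈)) (induced (toE f∈)) (linear (toE e∈) (toE f∈) e≢f) le)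
    (AllPairs.zip (↭ₛ.Unique-resp-↭ (setoid _) (↭⇒↭ₛ (↭-sym (sort-↭ (E H)))) (distinct H)
                  , Sorted⇒AllPairs (DecTotalOrder.totalOrder byDepth) (sort-↗ (E H))))

  conclude : AllPairs Disjoint es ⊎ Valid es → Σ (Digraph (n H)) λ D → Acyclic D × IsNicheHypergraphOf H D
  -- Two hyperedges meet at the root `v₀`, so the family is not pairwise disjoint.
  conclude (inj₁ d) with distinct-pair deg₀ (Unique.filter⁺ (v₀ ∈?_) (distinct H))
  ... | e , f , e∈ , f∈ , e≢f =
    let e∈E , v∈e = ∈-filter⁻ (v₀ ∈?_) {xs = E H} e∈
        f∈E , v∈f = ∈-filter⁻ (v₀ ∈?_) {xs = E H} f∈
    in ⊥-elim (pairwise d (fromE e∈E) (fromE f∈E) e≢f v∈e v∈f)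
  conclude (inj₂ (xs , G , C , to , from)) = digraph , acyclic , λ e →
    (λ e∈ → noLoops H e∈ , edge⇒neighbourhood (from (fromE e∈))) , λ ne → toE (to (niche⇒edge ne))
    where open Realise G C
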